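{- The following hold. (1) For $a=1,\ldots,\rho_C$, the polynomial $f_a\big(\mathcal{A}^{(B,\mathbf b)},t\big)$ can be written in the form $$f_a\big(\mathcal{A}^{(B,\mathbf b)},t\big)=\sum_{J\subseteq[m],\ \bar r(J)=r(J)}(-1)^{\#J}\tilde{d}_J(a)\,t^{n-r(J)}.$$ (2) For any integers $1\le a,b\le\rho_C$, if $\gcd(a,\rho_C)=\gcd(b,\rho_C)$, then $f_a\big(\mathcal{A}^{(B,\mathbf b)},t\big)=f_b\big(\mathcal{A}^{(B,\mathbf b)},t\big)$. In other words, the quasi-polynomial $\chi^{\mathrm{quasi}}\big(\mathcal{A}^{(B,\mathbf b)},q\big)$ has the gcd property with respect to $\rho_C$. (3) For any integers $q>q_0$ and $1\le a\le\rho_C$, if $\gcd(q,\rho_C)=a$, then $$\chi^{\mathrm{quasi}}\big(\mathcal{A}^{(B,\mathbf b)},q\big)=f_a\big(\mathcal{A}^{(B,\mathbf b)},q\big).$$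
   Context: Let $A$ be an $m\times n$ integer matrix, $B$ an $l\times n$ integer matrix ($l=0$ is allowed), $\mathbf a\in\mathbb{Z}^m$, $\mathbf b\in\mathbb{Z}^l$, and $[m]=\{1,\dots,m\}$. (Italic $a,b$ are integers, bold $\mathbf a,\mathbf b$ are vectors.) For $J\subseteq[m]$, let $A_J$ and $\mathbf a_J$ consist of the rows of $A$ and entries of $\mathbf a$ indexed by $J$; $C_J=\begin{bmatrix}B\\ A_J\end{bmatrix}$, $\mathbf c_J=\begin{bmatrix}\mathbf b\\ \mathbf a_J\end{bmatrix}$, $\bar C_J=[C_J\ \mathbf c_J]$; $r(J)=\operatorname{rank}C_J$, $\bar r(J)=\operatorname{rank}\bar C_J$ (ranks over $\mathbb{Q}$). The invariant factors of an integer matrix are the nonzero diagonal entries (taken positive, each dividing the next) of its Smith normal form; let $d_{J,1}\mid\cdots\mid d_{J,r(J)}$ be those of $C_J$ and $\bar d_{J,1}\mid\cdots\mid\bar d_{J,\bar r(J)}$ those of $\bar C_J$. Put $\rho_C=\operatorname{lcm}\{d_{J,r(J)}: J\subseteq[m],\ \bar r(J)=r(J)\}$ and $q_0=\max\{\bar d_{J,\bar r(J)}: J\subseteq[m],\ \bar r(J)=r(J)+1\}$, with $q_0=0$ if no such $J$ exists; $d_{J,0}=1$ and the lcm of the empty set is $1$. For positive integers $q$ let $d_J(q)=\prod_{j=1}^{r(J)}\gcd(d_{J,j},q)$, and let $\tilde d_J(q)=d_J(q)$ if $\gcd(q,d_{J,j})=\gcd(q,\bar d_{J,j})$ for all $j=1,\dots,\bar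 r(J)$, and $\tilde d_J(q)=0$ otherwise, where $d_{J,\bar r(J)}:=0$ if $\bar r(J)=r(J)+1$ (and $\gcd(q,0)=q$). The characteristic quasi-polynomial is $$\chi^{\mathrm{quasi}}\big(\mathcal{A}^{(B,\mathbf b)},q\big)=\sum_{J\subseteq[m],\ \bar r(J)=r(J)}(-1)^{\#J}\tilde{d}_J(q)\,q^{n-r(J)},$$ a quasi-polynomial in $q$ with period $\rho_C$. For $j=1,\dots,\rho_C$, its $j$-constituent $f_j\big(\mathcal{A}^{(B,\mathbf b)},t\big)$ is the unique polynomial with $f_j\big(\mathcal{A}^{(B,\mathbf b)},q\big)=\chi^{\mathrm{quasi}}\big(\mathcal{A}^{(B,\mathbf b)},q\big)$ for all positive integers $q\equiv j\pmod{\rho_C}$. A quasi-polynomial with period $\rho$ and constituents $f_1,\dots,f_\rho$ has the gcd property with respect to $\rho$ if $f_a=f_b$ whenever $\gcd(a,\rho)=\gcd(b,\rho)$. -}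

module Defs where

open import Algebra.Bundles using (CommutativeRing)
open import Data.Bool.Base using (if_then_else_; true; false)
open import Data.Fin.Base using (Fin; zero; suc; toℕ; inject≤)
import Data.Fin.Properties as Fin
open import Data.Fin.Permutation.Components using (transpose; transpose-inverse)
open import Data.Fin.Subset using (Subset; inside; outside; ∣_∣)
open import Data.Integer.Base as ℤ using (ℤ; +_; -[1+_]; 0ℤ; 1ℤ; -1ℤ; _+_; _*_; -_; _/_; _%_)
import Data.Integer.Properties as ℤ
open import Data.Integer.DivMod using (a≡a%n+[a/n]*n; n%d<d)
open import Data.Integer.Divisibility.Signed as ℤ∣ using (divides; _∣?_) renaming (_∣_ to _∣ℤ_)
open import Data.Integer.Tactic.RingSolver using (solve-∀)
open import Data.List.Base as List using (List; []; _∷_; length; map; foldr; filter; applyUpTo)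
open import Data.List.Relation.Unary.All using (All; []; _∷_)
open import Data.List.Relation.Unary.Linked using (Linked; []; [-]; _∷_)
open import Data.Nat.Base as ℕ using (ℕ; zero; suc; z≤n; s≤s; _≤_; _<_; _∸_; _⊔_; ∣_-_∣)
import Data.Nat.Properties as ℕ
open import Data.Nat.ListAction using (product)
open import Data.Nat.Divisibility using (_∣_)
open import Data.Nat.GCD using (gcd)
open import Data.Nat.Induction using (<-wellFounded)
open import Data.Nat.LCM using (lcm)
open import Data.Product.Base using (Σ; ∃; _×_; _,_; proj₁; proj₂)
open import Data.Rational.Base as ℚ using (ℚ; 0ℚ)
import Data.Rational.Properties as ℚ
import Data.Rational.Unnormalised.Base as ℚᵘ
import Data.Rational.Unnormalised.Properties as ℚᵘ
open import Data.Rational.Literals using (fromℤ)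
open import Data.Vec.Base using ([]; _∷_)
open import Data.Vec.Functional as Vector using (Vector)
open import Data.Sum.Base using (_⊎_; inj₁; inj₂)
open import Function.Base using (_∘_; _$_)
open import Induction.WellFounded using (Acc; acc)
open import Relation.Binary.PropositionalEquality
open import Relation.Nullary using (¬_; Dec; yes; no; does; contradiction)

import Algebra.Properties.Semiring.Sum as Sum
module ∑ℤ = Sum ℤ.+-*-semiring
module ∑ℚ = Sum (CommutativeRing.semiring ℚ.+-*-commutativeRing)

private
  variable
    k l m n p : ℕ

Matrix : ℕ → ℕ → Set
Matrix m n = Vector (Vector ℤ n) m

infix 4 _≐_
_≐_ : Matrix m n → Matrix m n → Set
M ≐ N = ∀ i j → M i j ≡ N i j

infixl 7 _·_
_·_ : Matrix k m → Matrix m n → Matrix k n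
(M · N) i j = ∑ℤ.sum λ x → M i x * N x j

1ₘ : Matrix n n
1ₘ i j = if does (i Fin.≟ j) then 1ℤ else 0ℤ

record Unimodular (U : Matrix n n) : Set where
  field
    inverse  : Matrix n n
    inverseˡ : inverse · U ≐ 1ₘ
    inverseʳ : U · inverse ≐ 1ₘ

-- The j-th member of a list d₁, …, dᵣ, counted from 1, with the
-- conventions d₀ = 1 and dⱼ = 0 for j > r.
factor : List ℕ → ℕ → ℕ
factor ds       zero          = 1
factor []       (suc j)       = 0
factor (d ∷ ds) (suc zero)    = d
factor (d ∷ ds) (suc (suc j)) = factor ds (suc j)

diagonal : List ℕ → Matrix m n
diagonal ds i j = if does (toℕ i ℕ.≟ toℕ j) then + factor ds (suc (toℕ i)) else 0ℤ

-- `factors` lists the invariant factors: the nonzero diagonal entries of the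
-- Smith normal form.
record SmithForm (M : Matrix m n) : Set where
  field
    factors     : List ℕ
    length≤rows : length factors ≤ m
    length≤cols : length factors ≤ n
    positive    : All (0 <_) factors
    chain       : Linked _∣_ factors
    left        : Matrix m m
    right       : Matrix n n
    left-unimodular  : Unimodular left
    right-unimodular : Unimodular right
    diagonalises     : left · M · right ≐ diagonal factors

combination : Vector ℚ k → Vector (Vector ℚ m) k → Vector ℚ m
combination c v i = ∑ℚ.sum λ j → c j ℚ.* v j i

Independent : Vector (Vector ℚ m) k → Set
Independent v = ∀ c → (∀ i → combination c v i ≡ 0ℚ) → ∀ j → c j ≡ 0ℚ

InSpan : Vector (Vector ℚ m) k → Vector ℚ m → Set
InSpan v x = ∃ λ c → ∀ i → combination c v i ≡ x i

columns : Matrix m n → Vector (Vector ℚ m) n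
columns M j i = fromℤ (M i j)

-- A basis, over ℚ, of the space spanned by the columns of M.
record ColumnBasis (M : Matrix m n) : Set where
  field
    dimension   : ℕ
    basis       : Vector (Vector ℚ m) dimension
    independent : Independent basis
    inside-span : ∀ k → InSpan (columns M) (basis k)
    spanning    : ∀ j → InSpan basis (columns M j)

module SmithFormExistence where
  sum-cong : {f g : Vector ℤ n} → (∀ i → f i ≡ g i) → ∑ℤ.sum f ≡ ∑ℤ.sum g
  sum-cong = ∑ℤ.sum-cong-≗

  sum-0 : {f : Vector ℤ n} → (∀ i → f i ≡ 0ℤ) → ∑ℤ.sum f ≡ 0ℤ
  sum-0 {n} f≡0 = trans (sum-cong f≡0) (∑ℤ.sum-replicate-zero n)

  sum-1ₘ : ∀ (i : Fin n) (v : Vector ℤ n) → ∑ℤ.sum (λ x → 1ₘ i x * v x) ≡ v i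
  sum-1ₘ zero v = trans (cong₂ _+_ (ℤ.*-identityˡ (v zero)) (sum-0 (λ x → ℤ.*-zeroˡ (v (suc x)))))
                        (ℤ.+-identityʳ (v zero))
  sum-1ₘ (suc i) v = trans (cong₂ _+_ (ℤ.*-zeroˡ (v zero)) (sum-1ₘ i (v ∘ suc))) (ℤ.+-identityˡ (v (suc i)))

  1ₘ-sym : ∀ (i j : Fin n) → 1ₘ i j ≡ 1ₘ j i
  1ₘ-sym zero    zero    = refl
  1ₘ-sym zero    (suc j) = refl
  1ₘ-sym (suc i) zero    = refl
  1ₘ-sym (suc i) (suc j) = 1ₘ-sym i j

  infixl 8 _ᵀ
  _ᵀ : Matrix m n → Matrix n m
  (M ᵀ) i j = M j i

  ·-cong : {M M′ : Matrix k m} {N N′ : Matrix m n} → M ≐ M′ → N ≐ N′ → M · N ≐ M′ · N′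
  ·-cong p q i j = sum-cong λ x → cong₂ _*_ (p i x) (q x j)

  ·-congˡ : (M : Matrix k m) {N N′ : Matrix m n} → N ≐ N′ → M · N ≐ M · N′
  ·-congˡ M q i j = sum-cong λ x → cong (M i x *_) (q x j)

  ·-congʳ : {M M′ : Matrix k m} (N : Matrix m n) → M ≐ M′ → M · N ≐ M′ · N
  ·-congʳ N p i j = sum-cong λ x → cong (_* N x j) (p i x)

  ·-assoc : (M : Matrix k l) (N : Matrix l m) (P : Matrix m n) → M · N · P ≐ M · (N · P)
  ·-assoc {l = l} {m = m} M N P i j = begin
    ∑ℤ.sum (λ y → ∑ℤ.sum (λ x → M i x * N x y) * P y j)
      ≡⟨ sum-cong (λ y → ∑ℤ.*-distribʳ-sum (P y j) (λ x → M i x * N x y)) ⟩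
    ∑ℤ.sum (λ y → ∑ℤ.sum (λ x → M i x * N x y * P y j))
      ≡⟨ ∑ℤ.∑-comm (λ y x → M i x * N x y * P y j) ⟩
    ∑ℤ.sum (λ x → ∑ℤ.sum (λ y → M i x * N x y * P y j))
      ≡⟨ sum-cong (λ x → trans (sum-cong λ y → ℤ.*-assoc (M i x) (N x y) (P y j))
                               (sym (∑ℤ.*-distribˡ-sum (M i x) (λ y → N x y * P y j)))) ⟩
    ∑ℤ.sum (λ x → M i x * ∑ℤ.sum (λ y → N x y * P y j)) ∎
    where open ≡-Reasoning

  ·-identityˡ : (M : Matrix m n) → 1ₘ · M ≐ M
  ·-identityˡ M i j = sum-1ₘ i (λ x → M x j)

  ·-identityʳ : (M : Matrix m n) → M · 1ₘ ≐ M
  ·-identityʳ M i j = trans (sum-cong λ x → trans (ℤ.*-comm (M i x) (1ₘ x j)) (cong (_* M i x) (1ₘ-sym x j)))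
                            (sum-1ₘ j (M i))

  ·-ᵀ : (M : Matrix k m) (N : Matrix m n) → (M · N) ᵀ ≐ N ᵀ · M ᵀ
  ·-ᵀ M N i j = sum-cong λ x → ℤ.*-comm (M j x) (N x i)

  ≐-trans : {M N P : Matrix m n} → M ≐ N → N ≐ P → M ≐ P
  ≐-trans p q i j = trans (p i j) (q i j)

  ≐-sym : {M N : Matrix m n} → M ≐ N → N ≐ M
  ≐-sym p i j = sym (p i j)

  open Unimodular

  1-unimodular : Unimodular (1ₘ {n})
  1-unimodular .inverse  = 1ₘ
  1-unimodular .inverseˡ = ·-identityˡ 1ₘ
  1-unimodular .inverseʳ = ·-identityˡ 1ₘ

  cancel-middle : (U V V′ U′ : Matrix n n) → V · V′ ≐ 1ₘ → U · U′ ≐ 1ₘ → (U · V) · (V′ · U′) ≐ 1ₘ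
  cancel-middle U V V′ U′ v u =
    ≐-trans (·-assoc U V (V′ · U′))
   (≐-trans (·-congˡ U (≐-trans (≐-sym (·-assoc V V′ U′)) (≐-trans (·-congʳ U′ v) (·-identityˡ U′)))) u)

  ·-unimodular : {U V : Matrix n n} → Unimodular U → Unimodular V → Unimodular (U · V)
  ·-unimodular {U = U} {V} u v .inverse  = v .inverse · u .inverse
  ·-unimodular {U = U} {V} u v .inverseˡ = cancel-middle (v .inverse) (u .inverse) U V (u .inverseˡ) (v .inverseˡ)
  ·-unimodular {U = U} {V} u v .inverseʳ = cancel-middle U V (v .inverse) (u .inverse) (v .inverseʳ) (u .inverseʳ)

  ᵀ-unimodular : {U : Matrix n n} → Unimodular U → Unimodular (U ᵀ)
  ᵀ-unimodular {U = U} u .inverse = u .inverse ᵀ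
  ᵀ-unimodular {U = U} u .inverseˡ i j =
    trans (sym (·-ᵀ U (u .inverse) i j)) (trans (u .inverseʳ j i) (1ₘ-sym j i))
  ᵀ-unimodular {U = U} u .inverseʳ i j =
    trans (sym (·-ᵀ (u .inverse) U i j)) (trans (u .inverseˡ j i) (1ₘ-sym j i))

  infix 4 _~_
  record _~_ (M N : Matrix m n) : Set where
    constructor equivalence
    field
      {L} : Matrix m m
      {R} : Matrix n n
      L-unimodular : Unimodular L
      R-unimodular : Unimodular R
      transforms   : L · M · R ≐ N
  open _~_

  ~-reflexive : {M N : Matrix m n} → M ≐ N → M ~ N
  ~-reflexive {M = M} p = equivalence 1-unimodular 1-unimodular
    (≐-trans (·-identityʳ (1ₘ · M)) (≐-trans (·-identityˡ M) p))

  ~-trans : {M N P : Matrix m n} → M ~ N → N ~ P → M ~ P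
  ~-trans {M = M} (equivalence {L} {R} l r e) (equivalence {L′} {R′} l′ r′ e′) =
    equivalence (·-unimodular l′ l) (·-unimodular r r′)
      (≐-trans (≐-sym (·-assoc (L′ · L · M) R R′))
      (≐-trans (·-congʳ R′ (≐-trans (·-congʳ R (·-assoc L′ L M)) (≐-trans (·-assoc L′ (L · M) R) (·-congˡ L′ e)))) e′))

  ~-ᵀ : {M N : Matrix m n} → M ~ N → M ᵀ ~ N ᵀ
  ~-ᵀ {M = M} (equivalence {L} {R} l r e) = equivalence (ᵀ-unimodular r) (ᵀ-unimodular l)
    (λ i j → trans (·-assoc (R ᵀ) (M ᵀ) (L ᵀ) i j)
            (trans (sym (·-congˡ (R ᵀ) (·-ᵀ L M) i j))
            (trans (sym (·-ᵀ (L · M) R i j)) (e j i))))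

  left-~ : {M N : Matrix m n} {U : Matrix m m} → Unimodular U → U · M ≐ N → M ~ N
  left-~ {M = M} {U = U} u e = equivalence u 1-unimodular (≐-trans (·-identityʳ (U · M)) e)

  addRows : (i : Fin m) (c : Vector ℤ m) → Matrix m n → Matrix m n
  addRows i c M k x = M k x + c k * M i x

  shear : (i : Fin m) (c : Vector ℤ m) → Matrix m m
  shear i c = addRows i c 1ₘ

  shear-· : ∀ i (c : Vector ℤ m) (M : Matrix m n) → shear i c · M ≐ addRows i c M
  shear-· i c M k j = begin
    ∑ℤ.sum (λ x → (1ₘ k x + c k * 1ₘ i x) * M x j)
      ≡⟨ sum-cong (λ x → trans (ℤ.*-distribʳ-+ (M x j) (1ₘ k x) (c k * 1ₘ i x))
                               (cong (λ z → 1ₘ k x * M x j + z) (ℤ.*-assoc (c k) (1ₘ i x) (M x j)))) ⟩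
    ∑ℤ.sum (λ x → 1ₘ k x * M x j + c k * (1ₘ i x * M x j))
      ≡⟨ ∑ℤ.∑-distrib-+ (λ x → 1ₘ k x * M x j) (λ x → c k * (1ₘ i x * M x j)) ⟩
    ∑ℤ.sum (λ x → 1ₘ k x * M x j) + ∑ℤ.sum (λ x → c k * (1ₘ i x * M x j))
      ≡⟨ cong₂ _+_ (sum-1ₘ k (λ x → M x j))
                   (trans (sym (∑ℤ.*-distribˡ-sum (c k) (λ x → 1ₘ i x * M x j)))
                          (cong (c k *_) (sum-1ₘ i (λ x → M x j)))) ⟩
    M k j + c k * M i j ∎
    where open ≡-Reasoning

  shear-inverse : ∀ i (c c′ : Vector ℤ m) → (∀ k → c k + c′ k ≡ 0ℤ) → c′ i ≡ 0ℤ →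
                  shear i c · shear i c′ ≐ 1ₘ
  shear-inverse i c c′ cancels c′i≡0 k j = begin
    (shear i c · shear i c′) k j
      ≡⟨ shear-· i c (shear i c′) k j ⟩
    1ₘ k j + c′ k * 1ₘ i j + c k * (1ₘ i j + c′ i * 1ₘ i j)
      ≡⟨ cong (λ z → 1ₘ k j + c′ k * 1ₘ i j + c k * (1ₘ i j + z * 1ₘ i j)) c′i≡0 ⟩
    1ₘ k j + c′ k * 1ₘ i j + c k * (1ₘ i j + 0ℤ * 1ₘ i j)
      ≡⟨ rearrange (1ₘ k j) (1ₘ i j) (c k) (c′ k) ⟩
    1ₘ k j + (c k + c′ k) * 1ₘ i j
      ≡⟨ cong (λ z → 1ₘ k j + z * 1ₘ i j) (cancels k) ⟩
    1ₘ k j + 0ℤ * 1ₘ i j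
      ≡⟨ trans (cong (λ z → 1ₘ k j + z) (ℤ.*-zeroˡ (1ₘ i j))) (ℤ.+-identityʳ _) ⟩
    1ₘ k j ∎
    where
    open ≡-Reasoning
    rearrange : ∀ x y a b → x + b * y + a * (y + 0ℤ * y) ≡ x + (a + b) * y
    rearrange = solve-∀

  addRows-~ : ∀ (M : Matrix m n) i c → c i ≡ 0ℤ → M ~ addRows i c M
  addRows-~ M i c ci≡0 = left-~ unimodular (shear-· i c M)
    where
    unimodular : Unimodular (shear i c)
    unimodular .inverse  = shear i (-_ ∘ c)
    unimodular .inverseˡ = shear-inverse i (-_ ∘ c) c (ℤ.+-inverseˡ ∘ c) ci≡0
    unimodular .inverseʳ = shear-inverse i c (-_ ∘ c) (ℤ.+-inverseʳ ∘ c) (cong -_ ci≡0)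

  swapRows-~ : ∀ (M : Matrix (suc m) n) i → M ~ (λ k → M (transpose zero i k))
  swapRows-~ M i = left-~ unimodular (λ k j → sum-1ₘ (transpose zero i k) (λ x → M x j))
    where
    P P⁻¹ : Matrix _ _
    P k = 1ₘ (transpose zero i k)
    P⁻¹ k = 1ₘ (transpose i zero k)
    unimodular : Unimodular P
    unimodular .inverse = P⁻¹
    unimodular .inverseˡ k j = trans (sum-1ₘ (transpose i zero k) (λ x → P x j))
                                     (cong (λ z → 1ₘ z j) (transpose-inverse zero i {k}))
    unimodular .inverseʳ k j = trans (sum-1ₘ (transpose zero i k) (λ x → P⁻¹ x j))
                                     (cong (λ z → 1ₘ z j) (transpose-inverse i zero {k}))

  except : Fin n → Vector ℤ n → Vector ℤ n
  except i c k = if does (k Fin.≟ i) then 0ℤ else c k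

  except-at : ∀ i (c : Vector ℤ n) → except i c i ≡ 0ℤ
  except-at i c with i Fin.≟ i
  ... | yes _  = refl
  ... | no i≢i = contradiction refl i≢i

  except-off : ∀ i (c : Vector ℤ n) k → k ≢ i → except i c k ≡ c k
  except-off i c k k≢i with k Fin.≟ i
  ... | yes k≡i = contradiction k≡i k≢i
  ... | no _    = refl

  -- A non-multiple of the entry (i , j) in its column can be replaced by a
  -- nonzero remainder.
  reduceColumn : ∀ (M : Matrix m n) i j k → M i j ≢ 0ℤ → ¬ (M i j ∣ℤ M k j) →
                 ∃ λ N → M ~ N × N k j ≢ 0ℤ × ℤ.∣ N k j ∣ < ℤ.∣ M i j ∣
  reduceColumn {m} M i j k p≢0 p∤ = N , addRows-~ M i c (except-at i q) , N≢0 , N<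
    where
    instance
      p-nonZero : ℤ.NonZero (M i j)
      p-nonZero = ℤ.≢-nonZero p≢0
    q c : Vector ℤ m
    q x = - (M x j / M i j)
    c = except i q
    N = addRows i c M
    k≢i : k ≢ i
    k≢i refl = p∤ ℤ∣.∣-refl
    r = M k j % M i j
    N≡r : N k j ≡ + r
    N≡r = begin
      M k j + c k * M i j
        ≡⟨ cong₂ (λ y z → y + z * M i j) (a≡a%n+[a/n]*n (M k j) (M i j)) (except-off i q k k≢i) ⟩
      + r + (M k j / M i j) * M i j + - (M k j / M i j) * M i j
        ≡⟨ rearrange (+ r) (M k j / M i j) (M i j) ⟩
      + r ∎
      where
      open ≡-Reasoning
      rearrange : ∀ x y z → x + y * z + - y * z ≡ x
      rearrange = solve-∀
    N≢0 : N k j ≢ 0ℤ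
    N≢0 N≡0 = p∤ (divides (M k j / M i j)
      (trans (a≡a%n+[a/n]*n (M k j) (M i j))
      (trans (cong (_+ (M k j / M i j) * M i j) (trans (sym N≡r) N≡0)) (ℤ.+-identityˡ _))))
    N< : ℤ.∣ N k j ∣ < ℤ.∣ M i j ∣
    N< = subst (λ z → ℤ.∣ z ∣ < ℤ.∣ M i j ∣) (sym N≡r) (n%d<d (M k j) (M i j))

  reduceRow : ∀ (M : Matrix m n) i j k → M i j ≢ 0ℤ → ¬ (M i j ∣ℤ M i k) →
              ∃ λ N → M ~ N × N i k ≢ 0ℤ × ℤ.∣ N i k ∣ < ℤ.∣ M i j ∣
  reduceRow M i j k p≢0 p∤ = transposed (reduceColumn (M ᵀ) j i k p≢0 p∤)
    where
    transposed : (∃ λ N → M ᵀ ~ N × N k i ≢ 0ℤ × ℤ.∣ N k i ∣ < ℤ.∣ M i j ∣) → _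
    transposed (N , M~N , N≢0 , N<) = N ᵀ , ~-ᵀ M~N , N≢0 , N<

  -- If the entry (i , j) divides its column, that column can be made constant.
  levelColumn : ∀ (M : Matrix m n) i j k l → (∀ x → M i j ∣ℤ M x j) → M i j ∣ℤ M i l → ¬ (M i j ∣ℤ M k l) →
                ∃ λ N → M ~ N × N k j ≡ M i j × ¬ (M i j ∣ℤ N k l)
  levelColumn {m} M i j k l p∣col p∣il p∤kl =
    addRows i c M , addRows-~ M i c (except-at i q) , N≡p ,
    λ p∣N → p∤kl (ℤ∣.∣m+n∣n⇒∣m p∣N (ℤ∣.∣n⇒∣m*n (c k) p∣il))
    where
    q c : Vector ℤ m
    q x = 1ℤ + - ℤ∣.quotient (p∣col x)
    c = except i q
    k≢i : k ≢ i
    k≢i refl = p∤kl p∣il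
    N≡p : M k j + c k * M i j ≡ M i j
    N≡p = trans (cong₂ (λ y z → y + z * M i j) (ℤ∣._∣_.equality (p∣col k)) (except-off i q k k≢i))
                (rearrange (ℤ∣.quotient (p∣col k)) (M i j))
      where
      rearrange : ∀ y z → y * z + (1ℤ + - y) * z ≡ z
      rearrange = solve-∀

  Pivoted : Matrix (suc m) (suc n) → Set
  Pivoted M = ∃ λ N → M ~ N × N zero zero ≢ 0ℤ × (∀ i j → N zero zero ∣ℤ N i j)

  pivot-via : {M N : Matrix (suc m) (suc n)} → M ~ N → Pivoted N → Pivoted M
  pivot-via M~N (P , N~P , rest) = P , ~-trans M~N N~P , rest

  Improvement : (M : Matrix m n) → Fin m → Fin n → Set
  Improvement M i j = ∃ λ k → ∃ λ l → ∃ λ N → M ~ N × N k l ≢ 0ℤ × ℤ.∣ N k l ∣ < ℤ.∣ M i j ∣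

  improve : ∀ (M : Matrix m n) i j → M i j ≢ 0ℤ → (∀ k l → M i j ∣ℤ M k l) ⊎ Improvement M i j
  improve {m} {n} M i j p≢0 = checkColumn (Fin.all? λ k → M i j ∣? M k j)
    where
    Result : Set
    Result = (∀ k l → M i j ∣ℤ M k l) ⊎ Improvement M i j

    levelled : ∀ k l → (∃ λ N → M ~ N × N k j ≡ M i j × ¬ (M i j ∣ℤ N k l)) → Result
    levelled k l (N , M~N , N≡p , p∤N) = finish
      (reduceRow N k j l (λ N≡0 → p≢0 (trans (sym N≡p) N≡0)) (λ N∣ → p∤N (subst (_∣ℤ N k l) N≡p N∣)))
      where
      finish : (∃ λ P → N ~ P × P k l ≢ 0ℤ × ℤ.∣ P k l ∣ < ℤ.∣ N k j ∣) → Result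
      finish (P , N~P , P≢0 , P<) =
        inj₂ (k , l , P , ~-trans M~N N~P , P≢0 , subst (λ z → ℤ.∣ P k l ∣ < ℤ.∣ z ∣) N≡p P<)

    checkAll : (∀ k → M i j ∣ℤ M k j) → (∀ l → M i j ∣ℤ M i l) →
               Dec (∀ k → ∀ l → M i j ∣ℤ M k l) → Result
    checkAll column row (yes all) = inj₁ all
    checkAll column row (no ¬all) = badRow (Fin.¬∀⟶∃¬ m _ (λ k → Fin.all? λ l → M i j ∣? M k l) ¬all)
      where
      badEntry : ∀ k → (∃ λ l → ¬ (M i j ∣ℤ M k l)) → Result
      badEntry k (l , p∤) = levelled k l (levelColumn M i j k l column (row l) p∤)
      badRow : (∃ λ k → ¬ (∀ l → M i j ∣ℤ M k l)) → Result
      badRow (k , ¬row) = badEntry k (Fin.¬∀⟶∃¬ n _ (λ l → M i j ∣? M k l) ¬row)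

    checkRow : (∀ k → M i j ∣ℤ M k j) → Dec (∀ l → M i j ∣ℤ M i l) → Result
    checkRow column (yes row) = checkAll column row (Fin.all? λ k → Fin.all? λ l → M i j ∣? M k l)
    checkRow column (no ¬row) = bad (Fin.¬∀⟶∃¬ n _ (λ l → M i j ∣? M i l) ¬row)
      where
      bad : (∃ λ l → ¬ (M i j ∣ℤ M i l)) → Result
      bad (l , p∤) = inj₂ (i , l , reduceRow M i j l p≢0 p∤)

    checkColumn : Dec (∀ k → M i j ∣ℤ M k j) → Result
    checkColumn (yes column) = checkRow column (Fin.all? λ l → M i j ∣? M i l)
    checkColumn (no ¬column) = bad (Fin.¬∀⟶∃¬ m _ (λ k → M i j ∣? M k j) ¬column)
      where
      bad : (∃ λ k → ¬ (M i j ∣ℤ M k j)) → Result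
      bad (k , p∤) = inj₂ (k , j , reduceColumn M i j k p≢0 p∤)

  pivot : ∀ (M : Matrix (suc m) (suc n)) i j → M i j ≢ 0ℤ → Acc _<_ ℤ.∣ M i j ∣ → Pivoted M
  pivot {m} {n} M i j p≢0 (acc rec) = step (improve M i j p≢0)
    where
    M₁ N : Matrix (suc m) (suc n)
    M₁ k = M (transpose zero i k)
    N k l = M₁ k (transpose zero j l)

    step : (∀ k l → M i j ∣ℤ M k l) ⊎ Improvement M i j → Pivoted M
    step (inj₁ all) = N , ~-trans (swapRows-~ M i) (~-ᵀ (swapRows-~ (M₁ ᵀ) j)) , p≢0 ,
                      (λ k l → all (transpose zero i k) (transpose zero j l))
    step (inj₂ (k , l , P , M~P , P≢0 , P<)) = pivot-via M~P (pivot P k l P≢0 (rec P<))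

  block : ℤ → Matrix m n → Matrix (suc m) (suc n)
  block p M zero    zero    = p
  block p M zero    (suc j) = 0ℤ
  block p M (suc i) zero    = 0ℤ
  block p M (suc i) (suc j) = M i j

  block-· : ∀ p q (M : Matrix k m) (N : Matrix m n) → block p M · block q N ≐ block (p * q) (M · N)
  block-· {m = m} p q M N zero zero = trans (cong (λ z → p * q + z) (sum-0 λ (x : Fin m) → ℤ.*-zeroˡ 0ℤ)) (ℤ.+-identityʳ (p * q))
  block-· p q M N zero (suc j) = cong₂ _+_ (ℤ.*-zeroʳ p) (sum-0 λ x → ℤ.*-zeroˡ (N x j))
  block-· p q M N (suc i) zero = cong₂ _+_ (ℤ.*-zeroˡ q) (sum-0 λ x → ℤ.*-zeroʳ (M i x))
  block-· p q M N (suc i) (suc j) = trans (cong (_+ (M · N) i j) (ℤ.*-zeroˡ 0ℤ)) (ℤ.+-identityˡ _)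

  block-cong : ∀ {p q} {M N : Matrix m n} → p ≡ q → M ≐ N → block p M ≐ block q N
  block-cong p≡q M≐N zero    zero    = p≡q
  block-cong p≡q M≐N zero    (suc j) = refl
  block-cong p≡q M≐N (suc i) zero    = refl
  block-cong p≡q M≐N (suc i) (suc j) = M≐N i j

  block-1ₘ : block 1ℤ (1ₘ {n}) ≐ 1ₘ
  block-1ₘ zero    zero    = refl
  block-1ₘ zero    (suc j) = refl
  block-1ₘ (suc i) zero    = refl
  block-1ₘ (suc i) (suc j) = refl

  block-unimodular : ∀ {u} {U : Matrix n n} → u * u ≡ 1ℤ → Unimodular U → Unimodular (block u U)
  block-unimodular {u = u} {U} uu≡1 v .inverse  = block u (v .inverse)
  block-unimodular {u = u} {U} uu≡1 v .inverseˡ =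
    ≐-trans (block-· u u (v .inverse) U) (≐-trans (block-cong uu≡1 (v .inverseˡ)) block-1ₘ)
  block-unimodular {u = u} {U} uu≡1 v .inverseʳ =
    ≐-trans (block-· u u U (v .inverse)) (≐-trans (block-cong uu≡1 (v .inverseʳ)) block-1ₘ)

  block-~ : ∀ {u} p {M N : Matrix m n} → u * u ≡ 1ℤ → M ~ N → block p M ~ block (u * p) N
  block-~ {u = u} p {M} uu≡1 (equivalence {L} {R} l r e) =
    equivalence (block-unimodular uu≡1 l) (block-unimodular {u = 1ℤ} refl r)
      (≐-trans (·-congʳ (block 1ℤ R) (block-· u p L M))
      (≐-trans (block-· (u * p) 1ℤ (L · M) R) (block-cong (ℤ.*-identityʳ (u * p)) e)))

  Cleared : Matrix (suc m) (suc n) → Set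
  Cleared N = ∃ λ P → N ~ P × (∀ j → P zero j ≡ N zero j) × (∀ i → P (suc i) zero ≡ 0ℤ) ×
                      (∀ i j → N zero zero ∣ℤ P i j)

  clearColumn : ∀ (N : Matrix (suc m) (suc n)) → (∀ i j → N zero zero ∣ℤ N i j) → Cleared N
  clearColumn {m} N p∣ = addRows zero c N , addRows-~ N zero c refl , (λ j → row j) , column ,
                         λ i j → ℤ∣.∣m∣n⇒∣m+n (p∣ i j) (ℤ∣.∣n⇒∣m*n (c i) (p∣ zero j))
    where
    q : Fin m → ℤ
    q i = ℤ∣.quotient (p∣ (suc i) zero)
    c : Vector ℤ (suc m)
    c zero    = 0ℤ
    c (suc i) = - q i
    row : ∀ j → N zero j + 0ℤ * N zero j ≡ N zero j
    row j = trans (cong (λ z → N zero j + z) (ℤ.*-zeroˡ (N zero j))) (ℤ.+-identityʳ _)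
    column : ∀ i → N (suc i) zero + - q i * N zero zero ≡ 0ℤ
    column i = trans (cong (_+ - q i * N zero zero) (ℤ∣._∣_.equality (p∣ (suc i) zero)))
                     (rearrange (q i) (N zero zero))
      where
      rearrange : ∀ x y → x * y + - x * y ≡ 0ℤ
      rearrange = solve-∀

  Split : Matrix (suc m) (suc n) → Set
  Split {m} {n} M = ∃ λ p → Σ (Matrix m n) λ M′ → M ~ block p M′ × p ≢ 0ℤ × (∀ i j → p ∣ℤ M′ i j)

  split : (M : Matrix (suc m) (suc n)) → Pivoted M → Split M
  split M (N , M~N , p≢0 , p∣N) = clearRow (clearColumn N p∣N)
    where
    clearRow : Cleared N → Split M
    clearRow (P , N~P , row , column , p∣P) =
      assemble (clearColumn (P ᵀ) (λ i j → subst (_∣ℤ P j i) (sym (row zero)) (p∣P j i)))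
      where
      assemble : Cleared (P ᵀ) → Split M
      assemble (Q , Pᵀ~Q , row′ , column′ , p∣Q) =
        P zero zero , (λ i j → Q (suc j) (suc i)) ,
        ~-trans M~N (~-trans N~P (~-trans (~-ᵀ Pᵀ~Q) (~-reflexive blocks))) ,
        (λ p≡0 → p≢0 (trans (sym (row zero)) p≡0)) , (λ i j → p∣Q (suc j) (suc i))
        where
        blocks : Q ᵀ ≐ block (P zero zero) (λ i j → Q (suc j) (suc i))
        blocks zero    zero    = row′ zero
        blocks zero    (suc j) = column′ j
        blocks (suc i) zero    = trans (row′ (suc i)) (column i)
        blocks (suc i) (suc j) = refl

  ∣-sum : ∀ p (f : Vector ℤ n) → (∀ x → p ∣ℤ f x) → p ∣ℤ ∑ℤ.sum f
  ∣-sum {zero}  p f p∣f = divides 0ℤ (sym (ℤ.*-zeroˡ p))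
  ∣-sum {suc n} p f p∣f = ℤ∣.∣m∣n⇒∣m+n (p∣f zero) (∣-sum p (f ∘ suc) (p∣f ∘ suc))

  ∣-~ : ∀ p {M N : Matrix m n} → M ~ N → (∀ i j → p ∣ℤ M i j) → ∀ i j → p ∣ℤ N i j
  ∣-~ p {M} (equivalence {L} {R} _ _ e) p∣M i j = subst (p ∣ℤ_) (e i j)
    (∣-sum p _ λ x → ℤ∣.∣m⇒∣m*n (R x j) (∣-sum p _ λ y → ℤ∣.∣n⇒∣m*n (L i y) (p∣M y x)))

  signum : ∀ p → ∃ λ u → u * u ≡ 1ℤ × u * p ≡ + ℤ.∣ p ∣
  signum (+ p)    = 1ℤ , refl , ℤ.*-identityˡ (+ p)
  signum -[1+ p ] = -1ℤ , refl , ℤ.-1*i≡-i -[1+ p ]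

  block-diagonal : ∀ d ds → block (+ d) (diagonal {m} {n} ds) ≐ diagonal (d ∷ ds)
  block-diagonal d ds zero    zero    = refl
  block-diagonal d ds zero    (suc j) = refl
  block-diagonal d ds (suc i) zero    = refl
  block-diagonal d ds (suc i) (suc j) = refl

  diagonal-[] : (M : Matrix m n) → (∀ i j → M i j ≡ 0ℤ) → M ≐ diagonal []
  diagonal-[] M M≡0 i j with does (toℕ i ℕ.≟ toℕ j)
  ... | true  = M≡0 i j
  ... | false = M≡0 i j

  zero-smith : (M : Matrix m n) → (∀ i j → M i j ≡ 0ℤ) → SmithForm M
  zero-smith M M≡0 = record
    { factors = [] ; length≤rows = z≤n ; length≤cols = z≤n ; positive = [] ; chain = []
    ; left-unimodular = 1-unimodular ; right-unimodular = 1-unimodular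
    ; diagonalises = transforms (~-reflexive (diagonal-[] M M≡0)) }

  cons-chain : ∀ d ds → length ds ≤ m → length ds ≤ n →
               (∀ i j → + d ∣ℤ diagonal {m} {n} ds i j) → Linked _∣_ ds → Linked _∣_ (d ∷ ds)
  cons-chain d []       _       _       _  _ = [-]
  cons-chain d (e ∷ ds) (s≤s _) (s≤s _) d∣ c = ℤ∣.∣⇒∣ᵤ (d∣ zero zero) ∷ c

  cons-smith : ∀ {p} {M : Matrix (suc m) (suc n)} {M′ : Matrix m n} →
               M ~ block p M′ → p ≢ 0ℤ → (∀ i j → p ∣ℤ M′ i j) → SmithForm M′ → SmithForm M
  cons-smith {p = p} M~ p≢0 p∣M′ S = record
    { factors     = ℤ.∣ p ∣ ∷ factors
    ; length≤rows = s≤s length≤rows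
    ; length≤cols = s≤s length≤cols
    ; positive    = ℕ.n≢0⇒n>0 (p≢0 ∘ ℤ.∣i∣≡0⇒i≡0) ∷ positive
    ; chain       = cons-chain ℤ.∣ p ∣ factors length≤rows length≤cols
                      (λ i j → ℤ∣.∣-trans ℤ∣.∣m∣∣m (∣-~ p M′~ p∣M′ i j)) chain
    ; left-unimodular  = L-unimodular whole
    ; right-unimodular = R-unimodular whole
    ; diagonalises     = transforms whole
    }
    where
    open SmithForm S
    M′~ : _ ~ diagonal factors
    M′~ = equivalence left-unimodular right-unimodular diagonalises
    u = signum p
    whole = ~-trans M~ (~-trans (block-~ {u = proj₁ u} p (proj₁ (proj₂ u)) M′~)
              (~-reflexive (≐-trans (block-cong (proj₂ (proj₂ u)) (λ i j → refl))
                                    (block-diagonal ℤ.∣ p ∣ factors))))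

  nonzeroEntry : (M : Matrix m n) → (∀ i j → M i j ≡ 0ℤ) ⊎ (∃ λ i → ∃ λ j → M i j ≢ 0ℤ)
  nonzeroEntry {m} {n} M = check (Fin.all? λ i → Fin.all? λ j → M i j ℤ.≟ 0ℤ)
    where
    inRow : (∃ λ i → ¬ (∀ j → M i j ≡ 0ℤ)) → ∃ λ i → ∃ λ j → M i j ≢ 0ℤ
    inRow (i , ¬0) = i , Fin.¬∀⟶∃¬ n _ (λ j → M i j ℤ.≟ 0ℤ) ¬0
    check : Dec (∀ i → ∀ j → M i j ≡ 0ℤ) → _
    check (yes M≡0) = inj₁ M≡0
    check (no M≢0)  = inj₂ (inRow (Fin.¬∀⟶∃¬ m _ (λ i → Fin.all? λ j → M i j ℤ.≟ 0ℤ) M≢0))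

open SmithFormExistence

-- Opaque for type checking speed: everything known about the form is in the
-- fields of SmithForm.
opaque
  smithForm : (M : Matrix m n) → SmithForm M
  smithForm {zero}          M = zero-smith M (λ ())
  smithForm {suc m} {zero}  M = zero-smith M (λ _ ())
  smithForm {suc m} {suc n} M = step (nonzeroEntry M)
    where
    recurse : Split M → SmithForm M
    recurse (p , M′ , M~ , p≢0 , p∣M′) = cons-smith M~ p≢0 p∣M′ (smithForm M′)
    step : (∀ i j → M i j ≡ 0ℤ) ⊎ (∃ λ i → ∃ λ j → M i j ≢ 0ℤ) → SmithForm M
    step (inj₁ M≡0)            = zero-smith M M≡0
    step (inj₂ (i , j , Mij≢0)) = recurse (split M (pivot M i j Mij≢0 (<-wellFounded _)))

invariantFactors : Matrix m n → List ℕ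
invariantFactors M = SmithForm.factors (smithForm M)

module ColumnBasisExistence where
  fromℤ-+ : ∀ a b → fromℤ (a + b) ≡ fromℤ a ℚ.+ fromℤ b
  fromℤ-+ a b = ℚ.toℚᵘ-injective (ℚᵘ.≃-trans (ℚᵘ.*≡* (identity a b))
                                             (ℚᵘ.≃-sym (ℚ.toℚᵘ-homo-+ (fromℤ a) (fromℤ b))))
    where
    identity : ∀ a b → (a + b) * 1ℤ ≡ (a * 1ℤ + b * 1ℤ) * 1ℤ
    identity = solve-∀

  fromℤ-* : ∀ a b → fromℤ (a * b) ≡ fromℤ a ℚ.* fromℤ b
  fromℤ-* a b = ℚ.toℚᵘ-injective (ℚᵘ.≃-trans (ℚᵘ.*≡* refl)
                                             (ℚᵘ.≃-sym (ℚ.toℚᵘ-homo-* (fromℤ a) (fromℤ b))))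

  fromℤ-sum : (f : Vector ℤ n) → fromℤ (∑ℤ.sum f) ≡ ∑ℚ.sum (fromℤ ∘ f)
  fromℤ-sum {zero}  f = refl
  fromℤ-sum {suc n} f = trans (fromℤ-+ (f zero) _) (cong (fromℤ (f zero) ℚ.+_) (fromℤ-sum (f ∘ suc)))

  fromℤ-dot : (f g : Vector ℤ n) →
              ∑ℚ.sum (λ x → fromℤ (f x) ℚ.* fromℤ (g x)) ≡ fromℤ (∑ℤ.sum λ x → f x * g x)
  fromℤ-dot f g = trans (∑ℚ.sum-cong-≗ λ x → sym (fromℤ-* (f x) (g x))) (sym (fromℤ-sum λ x → f x * g x))

  sumℚ-0 : {f : Vector ℚ n} → (∀ i → f i ≡ 0ℚ) → ∑ℚ.sum f ≡ 0ℚ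
  sumℚ-0 {n} f≡0 = trans (∑ℚ.sum-cong-≗ f≡0) (∑ℚ.sum-replicate-zero n)

  sum-truncate : ∀ (r≤n : k ≤ n) (f : Vector ℤ n) → (∀ x → k ≤ toℕ x → f x ≡ 0ℤ) →
                 ∑ℤ.sum (λ x → f (inject≤ x r≤n)) ≡ ∑ℤ.sum f
  sum-truncate {zero}  z≤n       f f≡0 = sym (sum-0 λ x → f≡0 x z≤n)
  sum-truncate {suc k} (s≤s k≤n) f f≡0 = cong (λ z → f zero + z) (sum-truncate k≤n (f ∘ suc) λ x le → f≡0 (suc x) (s≤s le))

  factor-beyond : ∀ ds j → length ds ≤ j → factor ds (suc j) ≡ 0
  factor-beyond []       j       _        = refl
  factor-beyond (d ∷ ds) (suc j) (s≤s le) = factor-beyond ds j le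

  diagonal-beyond : ∀ ds (i : Fin m) (j : Fin n) → length ds ≤ toℕ j → diagonal ds i j ≡ 0ℤ
  diagonal-beyond []       i       j       le       = sym (diagonal-[] (λ _ _ → 0ℤ) (λ _ _ → refl) i j)
  diagonal-beyond (d ∷ ds) zero    (suc j) le       = refl
  diagonal-beyond (d ∷ ds) (suc i) (suc j) (s≤s le) = diagonal-beyond ds i j le

  diagonal-sum : ∀ ds (≤m : length ds ≤ m) (≤n : length ds ≤ n) (c : Vector ℚ (length ds)) j →
                 ∑ℚ.sum (λ k → fromℤ (diagonal ds (inject≤ j ≤m) (inject≤ k ≤n)) ℚ.* c k) ≡
                 fromℤ (+ List.lookup ds j) ℚ.* c j
  diagonal-sum (d ∷ ds) (s≤s ≤m) (s≤s ≤n) c zero = trans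
    (cong (fromℤ (+ d) ℚ.* c zero ℚ.+_) (sumℚ-0 λ k → ℚ.*-zeroˡ (c (suc k)))) (ℚ.+-identityʳ _)
  diagonal-sum (d ∷ ds) (s≤s ≤m) (s≤s ≤n) c (suc j) = trans
    (cong₂ ℚ._+_ (ℚ.*-zeroˡ (c zero)) (diagonal-sum ds ≤m ≤n (c ∘ suc) j)) (ℚ.+-identityˡ _)

  fromℤ-cancel : ∀ d c → 0 < d → fromℤ (+ d) ℚ.* c ≡ 0ℚ → c ≡ 0ℚ
  fromℤ-cancel (suc d) c _ dc≡0 = begin
    c                    ≡⟨ ℚ.*-identityˡ c ⟨
    ℚ.1ℚ ℚ.* c           ≡⟨ cong (ℚ._* c) (ℚ.*-inverseˡ q) ⟨
    ℚ.1/ q ℚ.* q ℚ.* c   ≡⟨ ℚ.*-assoc (ℚ.1/ q) q c ⟩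
    ℚ.1/ q ℚ.* (q ℚ.* c) ≡⟨ cong (ℚ.1/ q ℚ.*_) dc≡0 ⟩
    ℚ.1/ q ℚ.* 0ℚ        ≡⟨ ℚ.*-zeroʳ (ℚ.1/ q) ⟩
    0ℚ                   ∎
    where
    open ≡-Reasoning
    q = fromℤ (+ suc d)

  lookup-positive : ∀ {ds} → All (0 <_) ds → ∀ j → 0 < List.lookup ds j
  lookup-positive (d>0 ∷ _)   zero    = d>0
  lookup-positive (_ ∷ ds>0)  (suc j) = lookup-positive ds>0 j

  module _ {M : Matrix m n} (S : SmithForm M) where
    open SmithForm S renaming (left to U; right to V)
    open Unimodular left-unimodular renaming (inverse to U⁻¹; inverseˡ to U⁻¹U)
    open Unimodular right-unimodular renaming (inverse to V⁻¹; inverseʳ to VV⁻¹)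

    row : Fin (length factors) → Fin m
    row j = inject≤ j length≤rows

    col : Fin (length factors) → Fin n
    col k = inject≤ k length≤cols

    vectors : Vector (Vector ℚ m) (length factors)
    vectors k i = fromℤ ((M · V) i (col k))

    UMV : U · (M · V) ≐ diagonal factors
    UMV = ≐-trans (≐-sym (·-assoc U M V)) diagonalises

    MV-beyond : ∀ i x → length factors ≤ toℕ x → (M · V) i x ≡ 0ℤ
    MV-beyond i x le = begin
      (M · V) i x              ≡⟨ ·-identityˡ (M · V) i x ⟨
      (1ₘ · (M · V)) i x       ≡⟨ ·-congʳ (M · V) U⁻¹U i x ⟨
      (U⁻¹ · U · (M · V)) i x  ≡⟨ ·-assoc U⁻¹ U (M · V) i x ⟩
      (U⁻¹ · (U · (M · V))) i x ≡⟨ sum-0 (λ y → trans (cong (U⁻¹ i y *_) (trans (UMV y x) (diagonal-beyond factors y x le)))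
                                                      (ℤ.*-zeroʳ (U⁻¹ i y))) ⟩
      0ℤ                       ∎
      where open ≡-Reasoning

    vectors-spanning : ∀ j → InSpan vectors (columns M j)
    vectors-spanning j = (λ k → fromℤ (V⁻¹ (col k) j)) , λ i → begin
      ∑ℚ.sum (λ k → fromℤ (V⁻¹ (col k) j) ℚ.* fromℤ ((M · V) i (col k)))
        ≡⟨ fromℤ-dot (λ k → V⁻¹ (col k) j) (λ k → (M · V) i (col k)) ⟩
      fromℤ (∑ℤ.sum (λ k → V⁻¹ (col k) j * (M · V) i (col k)))
        ≡⟨ cong fromℤ (sum-truncate length≤cols (λ x → V⁻¹ x j * (M · V) i x)
             (λ x le → trans (cong (V⁻¹ x j *_) (MV-beyond i x le)) (ℤ.*-zeroʳ (V⁻¹ x j)))) ⟩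
      fromℤ (∑ℤ.sum (λ x → V⁻¹ x j * (M · V) i x))
        ≡⟨ cong fromℤ (sum-cong λ x → ℤ.*-comm (V⁻¹ x j) ((M · V) i x)) ⟩
      fromℤ ((M · V · V⁻¹) i j)
        ≡⟨ cong fromℤ (trans (·-assoc M V V⁻¹ i j) (trans (·-congˡ M VV⁻¹ i j) (·-identityʳ M i j))) ⟩
      fromℤ (M i j) ∎
      where open ≡-Reasoning

    vectors-inside : ∀ k → InSpan (columns M) (vectors k)
    vectors-inside k = (λ j → fromℤ (V j (col k))) , λ i →
      trans (fromℤ-dot (λ j → V j (col k)) (M i))
            (cong fromℤ (sum-cong λ j → ℤ.*-comm (V j (col k)) (M i j)))

    vectors-independent : Independent vectors
    vectors-independent c combination≡0 j = fromℤ-cancel (List.lookup factors j) (c j) (lookup-positive positive j) $ begin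
      fromℤ (+ List.lookup factors j) ℚ.* c j
        ≡⟨ diagonal-sum factors length≤rows length≤cols c j ⟨
      ∑ℚ.sum (λ k → fromℤ (diagonal factors (row j) (col k)) ℚ.* c k)
        ≡⟨ ∑ℚ.sum-cong-≗ (λ k → cong (ℚ._* c k) (trans (cong fromℤ (sym (UMV (row j) (col k))))
                                                       (sym (fromℤ-dot (U (row j)) (λ i → (M · V) i (col k)))))) ⟩
      ∑ℚ.sum (λ k → ∑ℚ.sum (λ i → fromℤ (U (row j) i) ℚ.* vectors k i) ℚ.* c k)
        ≡⟨ ∑ℚ.sum-cong-≗ (λ k → ∑ℚ.*-distribʳ-sum (c k) (λ i → fromℤ (U (row j) i) ℚ.* vectors k i)) ⟩
      ∑ℚ.sum (λ k → ∑ℚ.sum (λ i → fromℤ (U (row j) i) ℚ.* vectors k i ℚ.* c k))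
        ≡⟨ ∑ℚ.∑-comm (λ k i → fromℤ (U (row j) i) ℚ.* vectors k i ℚ.* c k) ⟩
      ∑ℚ.sum (λ i → ∑ℚ.sum (λ k → fromℤ (U (row j) i) ℚ.* vectors k i ℚ.* c k))
        ≡⟨ sumℚ-0 vanish ⟩
      0ℚ ∎
      where
      open ≡-Reasoning
      vanish : ∀ i → ∑ℚ.sum (λ k → fromℤ (U (row j) i) ℚ.* vectors k i ℚ.* c k) ≡ 0ℚ
      vanish i = begin
        ∑ℚ.sum (λ k → fromℤ (U (row j) i) ℚ.* vectors k i ℚ.* c k)
          ≡⟨ ∑ℚ.sum-cong-≗ (λ k → trans (ℚ.*-assoc (fromℤ (U (row j) i)) (vectors k i) (c k))
                                        (cong (fromℤ (U (row j) i) ℚ.*_) (ℚ.*-comm (vectors k i) (c k)))) ⟩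
        ∑ℚ.sum (λ k → fromℤ (U (row j) i) ℚ.* (c k ℚ.* vectors k i))
          ≡⟨ ∑ℚ.*-distribˡ-sum (fromℤ (U (row j) i)) (λ k → c k ℚ.* vectors k i) ⟨
        fromℤ (U (row j) i) ℚ.* combination c vectors i
          ≡⟨ trans (cong (fromℤ (U (row j) i) ℚ.*_) (combination≡0 i)) (ℚ.*-zeroʳ (fromℤ (U (row j) i))) ⟩
        0ℚ ∎

open ColumnBasisExistence

columnBasis : (M : Matrix m n) → ColumnBasis M
columnBasis M = record
  { basis       = vectors (smithForm M)
  ; independent = vectors-independent (smithForm M)
  ; inside-span = vectors-inside (smithForm M)
  ; spanning    = vectors-spanning (smithForm M)
  }

-- The dimension over ℚ of the column space.  The basis used is the one read
-- off from `smithForm M`, so rank M is definitionally the number of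
-- invariant factors.
rank : Matrix m n → ℕ
rank M = ColumnBasis.dimension (columnBasis M)

-- Coefficients from the constant term upwards; since trailing zeros are
-- allowed, equality of polynomials is _≈ₚ_.
Polynomial : Set
Polynomial = List ℚ

coefficient : Polynomial → ℕ → ℚ
coefficient []      k       = 0ℚ
coefficient (c ∷ f) zero    = c
coefficient (c ∷ f) (suc k) = coefficient f k

infix 4 _≈ₚ_
_≈ₚ_ : Polynomial → Polynomial → Set
f ≈ₚ g = ∀ k → coefficient f k ≡ coefficient g k

infixl 6 _+ₚ_
_+ₚ_ : Polynomial → Polynomial → Polynomial
[]      +ₚ g       = g
(c ∷ f) +ₚ []      = c ∷ f
(c ∷ f) +ₚ (d ∷ g) = c ℚ.+ d ∷ f +ₚ g

sumₚ : List Polynomial → Polynomial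
sumₚ = foldr _+ₚ_ []

monomial : ℚ → ℕ → Polynomial
monomial c zero    = c ∷ []
monomial c (suc k) = 0ℚ ∷ monomial c k

eval : Polynomial → ℚ → ℚ
eval []      x = 0ℚ
eval (c ∷ f) x = c ℚ.+ x ℚ.* eval f x

-- Only the values of χ at positive arguments matter; ρ ∣ ∣ q - j ∣ says that
-- q ≡ j modulo ρ.
IsConstituent : (ρ : ℕ) (χ : ℕ → ℤ) (j : ℕ) → Polynomial → Set
IsConstituent ρ χ j f = ∀ q → 0 < q → ρ ∣ ∣ q - j ∣ → eval f (fromℤ (+ q)) ≡ fromℤ (χ q)

subsets : ∀ m → List (Subset m)
subsets zero    = [] ∷ []
subsets (suc m) = map (outside ∷_) (subsets m) List.++ map (inside ∷_) (subsets m)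

-- The members of J in increasing order.
elements : (J : Subset m) → Vector (Fin m) ∣ J ∣
elements (inside  ∷ J) zero    = zero
elements (inside  ∷ J) (suc i) = suc (elements J i)
elements (outside ∷ J) i       = suc (elements J i)

module Arrangement {m n l : ℕ} (A : Matrix m n) (B : Matrix l n) (a : Vector ℤ m) (b : Vector ℤ l) where

  C : (J : Subset m) → Matrix (l ℕ.+ ∣ J ∣) n
  C J = B Vector.++ (A ∘ elements J)

  c : (J : Subset m) → Vector ℤ (l ℕ.+ ∣ J ∣)
  c J = b Vector.++ (a ∘ elements J)

  C̄ : (J : Subset m) → Matrix (l ℕ.+ ∣ J ∣) (n ℕ.+ 1)
  C̄ J i = C J i Vector.++ (c J i Vector.∷ Vector.[])

  r r̄ : Subset m → ℕ
  r J = rank (C J)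
  r̄ J = rank (C̄ J)

  d d̄ : Subset m → ℕ → ℕ
  d J = factor (invariantFactors (C J))
  d̄ J = factor (invariantFactors (C̄ J))

  central : List (Subset m)
  central = filter (λ J → r̄ J ℕ.≟ r J) (subsets m)

  -- Since r̄ J is r J or r J + 1, these are all the remaining subsets.
  noncentral : List (Subset m)
  noncentral = filter (λ J → r̄ J ℕ.≟ r J ℕ.+ 1) (subsets m)

  ρC : ℕ
  ρC = foldr lcm 1 (map (λ J → d J (r J)) central)

  q₀ : ℕ
  q₀ = foldr _⊔_ 0 (map (λ J → d̄ J (r̄ J)) noncentral)

  -- dcount J q and d̃ J q are the quantities written d_J(q) and d̃_J(q).
  dcount : Subset m → ℕ → ℕ
  dcount J q = product (applyUpTo (λ j → gcd (d J (suc j)) q) (r J))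

  d̃ : Subset m → ℕ → ℕ
  d̃ J q = if does (Fin.all? {n = r̄ J} λ j → gcd q (d J (suc (toℕ j))) ℕ.≟ gcd q (d̄ J (suc (toℕ j))))
          then dcount J q else 0

  sign : Subset m → ℤ
  sign J = -1ℤ ℤ.^ ∣ J ∣

  χ-quasi : ℕ → ℤ
  χ-quasi q = foldr _+_ 0ℤ (map (λ J → sign J * + d̃ J q * (+ q) ℤ.^ (n ∸ r J)) central)

{-# OPTIONS --safe #-}

-- For J with r̄(J) = r(J) every d_{J,j} divides ρ_C.  So does every d̄_{J,j}:
-- deleting a column of an integer matrix replaces each invariant factor by a
-- multiple of itself.  Hence d̃_J(q) depends only on gcd(q, ρ_C), which gives the
-- formula for the constituents, because two polynomials agreeing on an
-- arithmetic progression are equal.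
--
-- The divisibility is proved without minors.  Let diag(d) = P diag(e) Q, both
-- diagonals being divisibility chains.  Modulo e_{k+1} only the first k columns
-- of P diag(e) survive, so some unimodular vector w, supported on the first
-- k + 1 rows, satisfies w P diag(e) ≡ 0.  Then e_{k+1} divides w_i d_i for
-- i ≤ k + 1, hence w_i d_{k+1}, hence d_{k+1}.

module Submission where

open import Defs
open import Algebra.Bundles using (CommutativeRing)
open import Data.Bool.Base using (if_then_else_)
open import Data.Fin.Base as Fin using (Fin; toℕ; fromℕ; fromℕ<; inject≤; _↑ˡ_)
import Data.Fin.Properties as Fin
open import Data.Integer.Base as ℤ using (ℤ; +_; _*_; 0ℤ; 1ℤ)
import Data.Integer.Properties as ℤ
open import Data.Integer.Divisibility.Signed as ℤ∣ using () renaming (_∣_ to _∣ℤ_)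
open import Data.List.Base using (List; []; _∷_; map; foldr; length; applyUpTo)
open import Data.List.Membership.Propositional using (_∈_)
open import Data.List.Membership.Propositional.Properties using (∈-filter⁻; ∈-map⁺)
open import Data.List.Relation.Unary.Any using (here; there)
open import Data.List.Relation.Unary.Linked as Linked using (Linked; [-]; _∷_)
open import Data.Nat.Base as ℕ using (ℕ; zero; suc; z≤n; s≤s; _≤_; _<_; _∸_; _⊓_; ∣_-_∣)
import Data.Nat.Properties as ℕ
open import Data.Nat.Divisibility
open import Data.Nat.GCD using (gcd; gcd[m,n]∣m; gcd[m,n]∣n; gcd-greatest; gcd-comm)
open import Data.Nat.LCM using (lcm; m∣lcm[m,n]; n∣lcm[m,n])
open import Data.Nat.ListAction using (product)
open import Data.Product.Base using (∃; _×_; _,_; proj₂)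
open import Data.Rational.Base as ℚ using (ℚ; 0ℚ)
import Data.Rational.Properties as ℚ
open import Data.Rational.Literals using (fromℤ)
open import Data.Rational.Solver using (module +-*-Solver)
open import Data.Sum.Base using (inj₁; inj₂)
open import Data.Vec.Functional using (Vector)
open import Data.Vec.Functional.Properties using (lookup-++ˡ)
open import Function.Base using (_∘_)
open import Function.Bundles using (mk⇔)
open import Relation.Binary.PropositionalEquality
open import Relation.Nullary using (yes; no)
open import Relation.Nullary.Decidable using (dec-true; dec-false; does-⇔)

open SmithFormExistence using
  (sum-cong; sum-0; sum-1ₘ; ∣-sum; ·-cong; ·-congˡ; ·-congʳ; ·-assoc;
   ·-identityˡ; ·-identityʳ; ≐-trans; ≐-sym)
open ColumnBasisExistence using (fromℤ-+; fromℤ-*; fromℤ-cancel; factor-beyond)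

private
  variable
    k l m n p : ℕ

-- Invariant factors of a matrix with a column deleted

head-∣-factor : ∀ {d ds} → Linked _∣_ (d ∷ ds) → ∀ j → d ∣ factor (d ∷ ds) (suc j)
head-∣-factor _         zero    = ∣-refl
head-∣-factor [-]       (suc j) = _ ∣0
head-∣-factor (d∣e ∷ c) (suc j) = ∣-trans d∣e (head-∣-factor c j)

-- The values 1 at index 0 and 0 past the end of the list extend the divisibility chain in both
-- directions, so it holds at all indices.
factor-∣-mono : ∀ {ds} → Linked _∣_ ds → ∀ {i j} → i ≤ j → factor ds i ∣ factor ds j
factor-∣-mono         c {zero}                  _         = 1∣ _
factor-∣-mono {[]}    c {suc i}       {suc j}       _         = _ ∣0
factor-∣-mono {_ ∷ _} c {suc zero}    {suc j}       _         = head-∣-factor c j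
factor-∣-mono {_ ∷ _} c {suc (suc i)} {suc (suc j)} (s≤s i≤j) = factor-∣-mono (Linked.tail c) i≤j

1ₘ-diagonal : (i : Fin n) → 1ₘ i i ≡ 1ℤ
1ₘ-diagonal i = cong (if_then 1ℤ else 0ℤ) (dec-true (i Fin.≟ i) refl)

diagonal-on : ∀ ds (i : Fin m) (j : Fin n) → toℕ i ≡ toℕ j → diagonal ds i j ≡ + factor ds (suc (toℕ j))
diagonal-on ds i j i≡j = trans
  (cong (if_then + factor ds (suc (toℕ i)) else 0ℤ) (dec-true (toℕ i ℕ.≟ toℕ j) i≡j))
  (cong (λ x → + factor ds (suc x)) i≡j)

diagonal-off : ∀ ds (i : Fin m) (j : Fin n) → toℕ i ≢ toℕ j → diagonal ds i j ≡ 0ℤ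
diagonal-off ds i j i≢j =
  cong (if_then + factor ds (suc (toℕ i)) else 0ℤ) (dec-false (toℕ i ℕ.≟ toℕ j) i≢j)

-- The leading k by k block, written with `1ₘ j i` so that a sum over `i` collapses by `sum-1ₘ`.
diagonal-inject≤ : ∀ ds (k≤m : k ≤ m) (k≤n : k ≤ n) (i j : Fin k) →
                   diagonal ds (inject≤ i k≤m) (inject≤ j k≤n) ≡ 1ₘ j i * + factor ds (suc (toℕ j))
diagonal-inject≤ ds k≤m k≤n i j with j Fin.≟ i
... | yes refl = trans
  (diagonal-on ds _ (inject≤ j k≤n) (trans (Fin.toℕ-inject≤ j k≤m) (sym (Fin.toℕ-inject≤ j k≤n))))
  (trans (cong (λ x → + factor ds (suc x)) (Fin.toℕ-inject≤ j k≤n)) (sym (ℤ.*-identityˡ _)))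
... | no j≢i   = trans
  (diagonal-off ds (inject≤ i k≤m) (inject≤ j k≤n) λ eq → j≢i (Fin.toℕ-injective
    (trans (sym (Fin.toℕ-inject≤ j k≤n)) (trans (sym eq) (Fin.toℕ-inject≤ i k≤m)))))
  (sym (ℤ.*-zeroˡ (+ factor ds (suc (toℕ j)))))

∣-diagonal : ∀ {ds} → Linked _∣_ ds → ∀ k (i : Fin m) (j : Fin n) → k ≤ toℕ j →
             + factor ds (suc k) ∣ℤ diagonal ds i j
∣-diagonal {ds = ds} c k i j k≤j with toℕ i ℕ.≟ toℕ j
... | yes i≡j = subst (+ factor ds (suc k) ∣ℤ_) (sym (diagonal-on ds i j i≡j)) (ℤ∣.∣ᵤ⇒∣ (factor-∣-mono c (s≤s k≤j)))
... | no  i≢j = subst (+ factor ds (suc k) ∣ℤ_) (sym (diagonal-off ds i j i≢j)) (ℤ∣.∣ᵤ⇒∣ (_ ∣0))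

-- w is a row of a unimodular matrix bringing G to Smith normal form, and u the
-- corresponding column of its inverse.
leftKernel : (G : Matrix (suc k) l) → l ≤ k →
             ∃ λ (w : Vector ℤ (suc k)) → ∃ λ u →
             ∑ℤ.sum (λ i → w i * u i) ≡ 1ℤ × (∀ j → ∑ℤ.sum (λ i → w i * G i j) ≡ 0ℤ)
leftKernel {k} G l≤k =
  L last , (λ i → L⁻¹ i last) , trans (LL⁻¹ last last) (1ₘ-diagonal last) , vanishes
  where
  open SmithForm (smithForm G) renaming (left to L; right to R)
  open Unimodular left-unimodular renaming (inverse to L⁻¹; inverseʳ to LL⁻¹)
  open Unimodular right-unimodular renaming (inverse to R⁻¹; inverseʳ to RR⁻¹)
  last = fromℕ k
  vanishes : ∀ j → (L · G) last j ≡ 0ℤ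
  vanishes j = begin
    (L · G) last j                 ≡⟨ ·-identityʳ (L · G) last j ⟨
    (L · G · 1ₘ) last j            ≡⟨ ·-congˡ (L · G) RR⁻¹ last j ⟨
    (L · G · (R · R⁻¹)) last j     ≡⟨ ·-assoc (L · G) R R⁻¹ last j ⟨
    (L · G · R · R⁻¹) last j       ≡⟨ ·-congʳ R⁻¹ diagonalises last j ⟩
    (diagonal factors · R⁻¹) last j ≡⟨ sum-0 (λ x → trans (cong (_* R⁻¹ x j) (lastRow x)) (ℤ.*-zeroˡ (R⁻¹ x j))) ⟩
    0ℤ                             ∎
    where
    open ≡-Reasoning
    -- The diagonal position of row k would lie in column k, and the columns stop before it because
    -- `l ≤ k`.
    lastRow : ∀ x → diagonal factors last x ≡ 0ℤ
    lastRow x = diagonal-off factors last x λ eq →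
      ℕ.<⇒≢ (ℕ.<-≤-trans (Fin.toℕ<n x) l≤k) (trans (sym eq) (Fin.toℕ-fromℕ k))

-- `P` and `Q` are arbitrary integer matrices, possibly not square: `Q` will also absorb the
-- deletion of a column.
module _ {m m′ n n′ ds es} (P : Matrix m m′) (Q : Matrix n′ n)
         (ds-chain : Linked _∣_ ds) (es-chain : Linked _∣_ es)
         (D≐ : diagonal ds ≐ P · diagonal es · Q) where

  factor-∣-below : ∀ k → suc k ≤ m → suc k ≤ n → factor es (suc k) ∣ factor ds (suc k)
  factor-∣-below k k<m k<n = annihilated (leftKernel G (ℕ.m⊓n≤m k n′))
    where
    e d : ℤ
    e = + factor es (suc k)
    d = + factor ds (suc k)
    f : Fin (suc k) → ℤ
    f i = + factor ds (suc (toℕ i))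
    row : Fin (suc k) → Fin m
    row i = inject≤ i k<m
    H : Matrix (suc k) n′
    H i = (P · diagonal es) (row i)
    -- The columns surviving modulo `e`. There are `k ⊓ n′` of them, as the diagonal matrix may have
    -- fewer than k columns; either way they are fewer than the k + 1 rows.
    G : Matrix (suc k) (k ⊓ n′)
    G i x = H i (inject≤ x (ℕ.m⊓n≤n k n′))

    annihilated : (∃ λ (w : Vector ℤ (suc k)) → ∃ λ u →
                   ∑ℤ.sum (λ i → w i * u i) ≡ 1ℤ × (∀ j → ∑ℤ.sum (λ i → w i * G i j) ≡ 0ℤ)) →
                  factor es (suc k) ∣ factor ds (suc k)
    annihilated (w , u , wu≡1 , wG≡0) = ℤ∣.∣⇒∣ᵤ (subst (e ∣ℤ_) wud≡d (∣-sum e _ e∣wud))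
      where
      -- The first k columns vanish by the choice of `w`; in the others `e` divides every entry of
      -- `H`.
      e∣wH : ∀ x → e ∣ℤ ∑ℤ.sum (λ i → w i * H i x)
      e∣wH x with toℕ x ℕ.<? k
      ... | yes x<k = subst (e ∣ℤ_) (sym (trans (cong (λ y → ∑ℤ.sum (λ i → w i * H i y)) x≡) (wG≡0 x′)))
                        (ℤ∣.∣ᵤ⇒∣ (_ ∣0))
        where
        x<⊓ : toℕ x < k ⊓ n′
        x<⊓ = ℕ.⊓-glb x<k (Fin.toℕ<n x)
        x′ : Fin (k ⊓ n′)
        x′ = fromℕ< x<⊓
        x≡ : x ≡ inject≤ x′ (ℕ.m⊓n≤n k n′)
        x≡ = Fin.toℕ-injective (sym (trans (Fin.toℕ-inject≤ x′ _) (Fin.toℕ-fromℕ< x<⊓)))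
      ... | no x≮k  = ∣-sum e _ λ i → ℤ∣.∣n⇒∣m*n (w i) (∣-sum e _ λ y →
                        ℤ∣.∣n⇒∣m*n (P (row i) y) (∣-diagonal es-chain k y x (ℕ.≮⇒≥ x≮k)))

      -- As a one-row matrix, `w` can be moved across the product with `Q` by `·-assoc`.
      W : Matrix 1 (suc k)
      W _ = w

      e∣wD : ∀ y → e ∣ℤ ∑ℤ.sum (λ i → w i * diagonal ds (row i) y)
      e∣wD y = subst (e ∣ℤ_)
        (trans (·-assoc W H Q Fin.zero y) (sum-cong λ i → cong (w i *_) (sym (D≐ (row i) y))))
        (∣-sum e _ λ x → ℤ∣.∣m⇒∣m*n (Q x y) (e∣wH x))

      e∣wf : ∀ j → e ∣ℤ w j * f j
      e∣wf j = subst (e ∣ℤ_) equality (e∣wD (inject≤ j k<n))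
        where
        open ≡-Reasoning
        equality : ∑ℤ.sum (λ i → w i * diagonal ds (row i) (inject≤ j k<n)) ≡ w j * f j
        equality = begin
          ∑ℤ.sum (λ i → w i * diagonal ds (row i) (inject≤ j k<n))
            ≡⟨ sum-cong (λ i → trans (cong (w i *_) (diagonal-inject≤ ds k<m k<n i j))
                                     (trans (sym (ℤ.*-assoc (w i) (1ₘ j i) (f j)))
                                            (cong (_* f j) (ℤ.*-comm (w i) (1ₘ j i))))) ⟩
          ∑ℤ.sum (λ i → 1ₘ j i * w i * f j)
            ≡⟨ ∑ℤ.*-distribʳ-sum (f j) (λ i → 1ₘ j i * w i) ⟨
          ∑ℤ.sum (λ i → 1ₘ j i * w i) * f j
            ≡⟨ cong (_* f j) (sum-1ₘ j w) ⟩
          w j * f j ∎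

      -- `e` divides each `w i * d`. Weighting these by `u i` and summing leaves `d` itself, since
      -- the products `w i * u i` add up to 1.
      e∣wud : ∀ i → e ∣ℤ w i * u i * d
      e∣wud i = subst (e ∣ℤ_) (trans (ℤ.*-comm (u i) (w i * d)) (trans (ℤ.*-assoc (w i) d (u i))
                  (trans (cong (w i *_) (ℤ.*-comm d (u i))) (sym (ℤ.*-assoc (w i) (u i) d)))))
        (ℤ∣.∣n⇒∣m*n (u i) (ℤ∣.∣-trans (e∣wf i) (ℤ∣.*-monoʳ-∣ (w i) f∣d)))
        where
        f∣d : f i ∣ℤ d
        f∣d = ℤ∣.∣ᵤ⇒∣ (factor-∣-mono ds-chain (s≤s (Fin.toℕ≤pred[n] i)))

      wud≡d : ∑ℤ.sum (λ i → w i * u i * d) ≡ d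
      wud≡d = trans (sym (∑ℤ.*-distribʳ-sum d (λ i → w i * u i)))
                    (trans (cong (_* d) wu≡1) (ℤ.*-identityˡ d))

  -- An index inside `ds` lies within both dimensions; past the end the factor is 0, which
  -- everything divides.
  diagonal-factor-∣ : length ds ≤ m → length ds ≤ n → ∀ j → factor es j ∣ factor ds j
  diagonal-factor-∣ ≤m ≤n zero    = ∣-refl
  diagonal-factor-∣ ≤m ≤n (suc k) with k ℕ.<? length ds
  ... | yes k<ds = factor-∣-below k (ℕ.≤-trans k<ds ≤m) (ℕ.≤-trans k<ds ≤n)
  ... | no  k≮ds = subst (factor es (suc k) ∣_) (sym (factor-beyond ds k (ℕ.≮⇒≥ k≮ds))) (_ ∣0)

undiagonalise : {M : Matrix m n} (S : SmithForm M) → let open SmithForm S in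
                M ≐ Unimodular.inverse left-unimodular · diagonal factors · Unimodular.inverse right-unimodular
undiagonalise {M = M} S = ≐-sym
  (≐-trans (·-congʳ V⁻¹ (·-congˡ U⁻¹ (≐-sym diagonalises)))
  (≐-trans (·-congʳ V⁻¹ (≐-sym (·-assoc U⁻¹ (U · M) V)))
  (≐-trans (·-assoc (U⁻¹ · (U · M)) V V⁻¹)
  (≐-trans (·-cong (≐-trans (≐-sym (·-assoc U⁻¹ U M)) (≐-trans (·-congʳ M U⁻¹U) (·-identityˡ M))) VV⁻¹)
           (·-identityʳ M)))))
  where
  open SmithForm S renaming (left to U; right to V)
  open Unimodular left-unimodular renaming (inverse to U⁻¹; inverseˡ to U⁻¹U)
  open Unimodular right-unimodular renaming (inverse to V⁻¹; inverseʳ to VV⁻¹)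

-- Inserting the Smith decomposition of `N` into that of `M` expresses one diagonal matrix through
-- the other.
factor-∣-·ʳ : (M : Matrix m n) (N : Matrix m p) (Y : Matrix p n) → M ≐ N · Y →
              ∀ j → factor (invariantFactors N) j ∣ factor (invariantFactors M) j
factor-∣-·ʳ M N Y M≐NY =
  diagonal-factor-∣ (U · U⁻¹) (V⁻¹ · (Y · V)) (SmithForm.chain S) (SmithForm.chain T) equality
    (SmithForm.length≤rows S) (SmithForm.length≤cols S)
  where
  S = smithForm M
  T = smithForm N
  U = SmithForm.left S
  V = SmithForm.right S
  E = diagonal (SmithForm.factors T)
  -- `U⁻¹` and `V⁻¹` come from the Smith form of `N`; they are not the inverses of `U` and `V`,
  -- which come from that of `M`.
  U⁻¹ = Unimodular.inverse (SmithForm.left-unimodular T)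
  V⁻¹ = Unimodular.inverse (SmithForm.right-unimodular T)
  equality : diagonal (SmithForm.factors S) ≐ U · U⁻¹ · E · (V⁻¹ · (Y · V))
  equality =
    ≐-trans (≐-sym (SmithForm.diagonalises S))
   (≐-trans (·-congʳ V (·-congˡ U (≐-trans M≐NY (·-congʳ Y (undiagonalise T)))))
   (≐-trans (·-congʳ V (≐-sym (·-assoc U (U⁻¹ · E · V⁻¹) Y)))
   (≐-trans (·-assoc (U · (U⁻¹ · E · V⁻¹)) Y V)
   (≐-trans (·-congʳ (Y · V) (≐-trans (≐-sym (·-assoc U (U⁻¹ · E) V⁻¹))
                                      (·-congʳ V⁻¹ (≐-sym (·-assoc U U⁻¹ E)))))
            (·-assoc (U · U⁻¹ · E) V⁻¹ (Y · V))))))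

-- Polynomials agreeing on an arithmetic progression

eval-0 : ∀ f x → (∀ k → coefficient f k ≡ 0ℚ) → eval f x ≡ 0ℚ
eval-0 []      x f≡0 = refl
eval-0 (c ∷ f) x f≡0 = trans (cong₂ (λ a b → a ℚ.+ x ℚ.* b) (f≡0 0) (eval-0 f x (f≡0 ∘ suc)))
                             (trans (ℚ.+-identityˡ _) (ℚ.*-zeroʳ x))

eval-cong : ∀ f g x → f ≈ₚ g → eval f x ≡ eval g x
eval-cong []      g       x f≈g = sym (eval-0 g x (sym ∘ f≈g))
eval-cong (c ∷ f) []      x f≈g = eval-0 (c ∷ f) x f≈g
eval-cong (c ∷ f) (d ∷ g) x f≈g = cong₂ (λ a b → a ℚ.+ x ℚ.* b) (f≈g 0) (eval-cong f g x (f≈g ∘ suc))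

eval-+ₚ : ∀ f g x → eval (f +ₚ g) x ≡ eval f x ℚ.+ eval g x
eval-+ₚ []      g       x = sym (ℚ.+-identityˡ _)
eval-+ₚ (c ∷ f) []      x = sym (ℚ.+-identityʳ _)
eval-+ₚ (c ∷ f) (d ∷ g) x = trans (cong (λ z → c ℚ.+ d ℚ.+ x ℚ.* z) (eval-+ₚ f g x))
  (solve 5 (λ c d x a b → c :+ d :+ x :* (a :+ b) := c :+ x :* a :+ (d :+ x :* b)) refl c d x (eval f x) (eval g x))
  where open +-*-Solver

coefficient-+ₚ : ∀ f g k → coefficient (f +ₚ g) k ≡ coefficient f k ℚ.+ coefficient g k
coefficient-+ₚ []      g       k       = sym (ℚ.+-identityˡ _)
coefficient-+ₚ (c ∷ f) []      k       = sym (ℚ.+-identityʳ _)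
coefficient-+ₚ (c ∷ f) (d ∷ g) zero    = refl
coefficient-+ₚ (c ∷ f) (d ∷ g) (suc k) = coefficient-+ₚ f g k

negₚ : Polynomial → Polynomial
negₚ = map (ℚ.-_)

eval-negₚ : ∀ f x → eval (negₚ f) x ≡ ℚ.- eval f x
eval-negₚ []      x = refl
eval-negₚ (c ∷ f) x = trans (cong (λ z → ℚ.- c ℚ.+ x ℚ.* z) (eval-negₚ f x))
  (solve 3 (λ c x a → :- c :+ x :* (:- a) := :- (c :+ x :* a)) refl c x (eval f x))
  where open +-*-Solver

coefficient-negₚ : ∀ f k → coefficient (negₚ f) k ≡ ℚ.- coefficient f k
coefficient-negₚ []      k       = refl
coefficient-negₚ (c ∷ f) zero    = refl
coefficient-negₚ (c ∷ f) (suc k) = coefficient-negₚ f k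

-- The quotient of c ∷ f by t - y, for any c.
horner : ℚ → Polynomial → Polynomial
horner y []      = []
horner y (c ∷ f) = eval (c ∷ f) y ∷ horner y f

length-horner : ∀ y f → length (horner y f) ≡ length f
length-horner y []      = refl
length-horner y (c ∷ f) = cong suc (length-horner y f)

-- Division with remainder by t - y, taken at t = y + z so that the divisor becomes `z`.
eval-horner : ∀ c f y z → eval (c ∷ f) (y ℚ.+ z) ≡ eval (c ∷ f) y ℚ.+ z ℚ.* eval (horner y f) (y ℚ.+ z)
eval-horner c [] y z =
  solve 3 (λ c y z → c :+ (y :+ z) :* con 0ℚ := c :+ y :* con 0ℚ :+ z :* con 0ℚ) refl c y z
  where open +-*-Solver
eval-horner c (e ∷ f) y z = trans (cong (λ a → c ℚ.+ (y ℚ.+ z) ℚ.* a) (eval-horner e f y z))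
  (solve 5 (λ c y z a h → c :+ (y :+ z) :* (a :+ z :* h) := c :+ y :* a :+ z :* (a :+ (y :+ z) :* h))
    refl c y z (eval (e ∷ f) y) (eval (horner y f) (y ℚ.+ z)))
  where open +-*-Solver

constant-0 : ∀ c f y → eval (c ∷ f) y ≡ 0ℚ → (∀ k → coefficient f k ≡ 0ℚ) → ∀ k → coefficient (c ∷ f) k ≡ 0ℚ
constant-0 c f y root f≡0 (suc k) = f≡0 k
constant-0 c f y root f≡0 zero    = begin
  c                   ≡⟨ ℚ.+-identityʳ c ⟨
  c ℚ.+ 0ℚ            ≡⟨ cong (c ℚ.+_) (ℚ.*-zeroʳ y) ⟨
  c ℚ.+ y ℚ.* 0ℚ      ≡⟨ cong (λ a → c ℚ.+ y ℚ.* a) (eval-0 f y f≡0) ⟨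
  eval (c ∷ f) y      ≡⟨ root ⟩
  0ℚ                  ∎
  where open ≡-Reasoning

-- The coefficients of `horner y f` are the values at `y` of the nonempty tails of `f`, so they
-- determine `f` from the top coefficient down.
horner-0 : ∀ y f → (∀ k → coefficient (horner y f) k ≡ 0ℚ) → ∀ k → coefficient f k ≡ 0ℚ
horner-0 y []      h≡0 = h≡0
horner-0 y (c ∷ f) h≡0 = constant-0 c f y (h≡0 0) (horner-0 y f (h≡0 ∘ suc))

-- The first point is a root. The quotient by the corresponding linear factor is shorter and
-- vanishes at the later points, a progression starting at `a + ρ`. The induction is on the bound
-- `n` because the quotient is not a subterm.
vanishing : ∀ n f → length f ≤ n → ∀ a ρ → 0 < ρ → (∀ k → eval f (fromℤ (+ (a ℕ.+ k ℕ.* ρ))) ≡ 0ℚ) →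
            ∀ k → coefficient f k ≡ 0ℚ
vanishing n       []      _         a ρ ρ>0 root = λ _ → refl
vanishing (suc n) (c ∷ f) (s≤s f≤n) a ρ ρ>0 root = constant-0 c f y root₀ (horner-0 y f
  (vanishing n (horner y f) (subst (_≤ n) (sym (length-horner y f)) f≤n) (a ℕ.+ ρ) ρ ρ>0 root′))
  where
  y = fromℤ (+ a)
  root₀ : eval (c ∷ f) y ≡ 0ℚ
  root₀ = trans (cong (λ b → eval (c ∷ f) (fromℤ (+ b))) (sym (ℕ.+-identityʳ a))) (root 0)
  root′ : ∀ k → eval (horner y f) (fromℤ (+ (a ℕ.+ ρ ℕ.+ k ℕ.* ρ))) ≡ 0ℚ
  -- The distance `s` from `a` to the later point is at least `ρ`, hence positive, and can be
  -- cancelled.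
  root′ k = fromℤ-cancel s _ (ℕ.≤-trans ρ>0 (ℕ.m≤m+n ρ (k ℕ.* ρ))) (begin
    z ℚ.* eval (horner y f) (fromℤ (+ (a ℕ.+ ρ ℕ.+ k ℕ.* ρ)))
      ≡⟨ cong (λ x → z ℚ.* eval (horner y f) x) (trans (cong (λ b → fromℤ (+ b)) (ℕ.+-assoc a ρ (k ℕ.* ρ))) point) ⟩
    z ℚ.* eval (horner y f) (y ℚ.+ z)
      ≡⟨ ℚ.+-identityˡ _ ⟨
    0ℚ ℚ.+ z ℚ.* eval (horner y f) (y ℚ.+ z)
      ≡⟨ cong (ℚ._+ z ℚ.* eval (horner y f) (y ℚ.+ z)) root₀ ⟨
    eval (c ∷ f) y ℚ.+ z ℚ.* eval (horner y f) (y ℚ.+ z)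
      ≡⟨ eval-horner c f y z ⟨
    eval (c ∷ f) (y ℚ.+ z)
      ≡⟨ cong (eval (c ∷ f)) point ⟨
    eval (c ∷ f) (fromℤ (+ (a ℕ.+ s)))
      ≡⟨ root (suc k) ⟩
    0ℚ ∎)
    where
    open ≡-Reasoning
    s = ρ ℕ.+ k ℕ.* ρ
    z = fromℤ (+ s)
    point : fromℤ (+ (a ℕ.+ s)) ≡ y ℚ.+ z
    point = fromℤ-+ (+ a) (+ s)

≈ₚ-from-progression : ∀ f g a ρ → 0 < ρ →
  (∀ k → eval f (fromℤ (+ (a ℕ.+ k ℕ.* ρ))) ≡ eval g (fromℤ (+ (a ℕ.+ k ℕ.* ρ)))) → f ≈ₚ g
≈ₚ-from-progression f g a ρ ρ>0 agree k = x-y≡0⇒x≡y (coefficient f k) (coefficient g k)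
  (trans (sym (trans (coefficient-+ₚ f (negₚ g) k) (cong (coefficient f k ℚ.+_) (coefficient-negₚ g k))))
         (vanishing _ (f +ₚ negₚ g) ℕ.≤-refl a ρ ρ>0 root k))
  where
  open import Algebra.Properties.Group (CommutativeRing.+-group ℚ.+-*-commutativeRing)
    using () renaming (x∙y⁻¹≈ε⇒x≈y to x-y≡0⇒x≡y)
  root : ∀ k → eval (f +ₚ negₚ g) (fromℤ (+ (a ℕ.+ k ℕ.* ρ))) ≡ 0ℚ
  root k = trans (eval-+ₚ f (negₚ g) x) (trans (cong₂ ℚ._+_ (agree k) (eval-negₚ g x)) (ℚ.+-inverseʳ (eval g x)))
    where x = fromℤ (+ (a ℕ.+ k ℕ.* ρ))

-- Evaluation of integral monomials and of sums

eval-monomial : ∀ c q k → eval (monomial (fromℤ c) k) (fromℤ q) ≡ fromℤ (c * q ℤ.^ k)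
eval-monomial c q zero    = begin
  fromℤ c ℚ.+ fromℤ q ℚ.* 0ℚ ≡⟨ cong (fromℤ c ℚ.+_) (ℚ.*-zeroʳ (fromℤ q)) ⟩
  fromℤ c ℚ.+ 0ℚ             ≡⟨ ℚ.+-identityʳ _ ⟩
  fromℤ c                    ≡⟨ cong fromℤ (ℤ.*-identityʳ c) ⟨
  fromℤ (c * 1ℤ)             ∎
  where open ≡-Reasoning
eval-monomial c q (suc k) = begin
  0ℚ ℚ.+ fromℤ q ℚ.* eval (monomial (fromℤ c) k) (fromℤ q)
    ≡⟨ ℚ.+-identityˡ _ ⟩
  fromℤ q ℚ.* eval (monomial (fromℤ c) k) (fromℤ q)
    ≡⟨ cong (fromℤ q ℚ.*_) (eval-monomial c q k) ⟩
  fromℤ q ℚ.* fromℤ (c * q ℤ.^ k)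
    ≡⟨ fromℤ-* q (c * q ℤ.^ k) ⟨
  fromℤ (q * (c * q ℤ.^ k))
    ≡⟨ cong fromℤ (trans (sym (ℤ.*-assoc q c (q ℤ.^ k))) (trans (cong (_* q ℤ.^ k) (ℤ.*-comm q c)) (ℤ.*-assoc c q (q ℤ.^ k)))) ⟩
  fromℤ (c * (q * q ℤ.^ k)) ∎
  where open ≡-Reasoning

-- Equality is asked only for members of the list, since for the quasi-polynomial it comes from the
-- centrality of J.
eval-sumₚ : ∀ {a} {X : Set a} (F : X → Polynomial) (v : X → ℤ) x (xs : List X) →
            (∀ {y} → y ∈ xs → eval (F y) x ≡ fromℤ (v y)) →
            eval (sumₚ (map F xs)) x ≡ fromℤ (foldr ℤ._+_ 0ℤ (map v xs))
eval-sumₚ F v x []       _  = refl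
eval-sumₚ F v x (y ∷ ys) eq = trans (eval-+ₚ (F y) (sumₚ (map F ys)) x)
  (trans (cong₂ ℚ._+_ (eq (here refl)) (eval-sumₚ F v x ys (eq ∘ there)))
         (sym (fromℤ-+ (v y) (foldr ℤ._+_ 0ℤ (map v ys)))))

-- Dependence on gcd(q, ρ_C)

-- As `d` divides `ρ`, `gcd q d` divides `gcd q ρ`, which equals `gcd q′ ρ` and so divides `q′`; the
-- converse is symmetric.
gcd-cong-∣ : ∀ {d ρ} q q′ → d ∣ ρ → gcd q ρ ≡ gcd q′ ρ → gcd q d ≡ gcd q′ d
gcd-cong-∣ {d} {ρ} q q′ d∣ρ eq = ∣-antisym (half q q′ eq) (half q′ q (sym eq))
  where
  half : ∀ q q′ → gcd q ρ ≡ gcd q′ ρ → gcd q d ∣ gcd q′ d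
  half q q′ eq = gcd-greatest
    (∣-trans (gcd-greatest (gcd[m,n]∣m q d) (∣-trans (gcd[m,n]∣n q d) d∣ρ))
             (∣-trans (∣-reflexive eq) (gcd[m,n]∣m q′ ρ)))
    (gcd[m,n]∣n q d)

∣-transfer : ∀ {g} a b → g ∣ ∣ a - b ∣ → g ∣ a → g ∣ b
∣-transfer {g} a b g∣a-b g∣a with ℕ.≤-total a b
... | inj₁ a≤b = ∣m∸n∣n⇒∣m g a≤b (subst (g ∣_) (ℕ.m≤n⇒∣m-n∣≡n∸m a≤b) g∣a-b) g∣a
... | inj₂ b≤a = ∣m+n∣m⇒∣n (subst (g ∣_) (sym (ℕ.m∸n+n≡m b≤a)) g∣a)
                           (subst (g ∣_) (ℕ.m≤n⇒∣n-m∣≡n∸m b≤a) g∣a-b)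

gcd-cong-mod : ∀ {ρ} a b → ρ ∣ ∣ a - b ∣ → gcd a ρ ≡ gcd b ρ
gcd-cong-mod {ρ} a b ρ∣ = ∣-antisym (half a b ρ∣) (half b a (subst (ρ ∣_) (ℕ.∣-∣-comm a b) ρ∣))
  where
  half : ∀ a b → ρ ∣ ∣ a - b ∣ → gcd a ρ ∣ gcd b ρ
  half a b ρ∣ = gcd-greatest (∣-transfer a b (∣-trans (gcd[m,n]∣n a ρ) ρ∣) (gcd[m,n]∣m a ρ)) (gcd[m,n]∣n a ρ)

gcd-idem : ∀ q ρ → gcd (gcd q ρ) ρ ≡ gcd q ρ
gcd-idem q ρ = ∣-antisym (gcd[m,n]∣m _ ρ) (gcd-greatest ∣-refl (gcd[m,n]∣n q ρ))

∈⇒∣lcm : ∀ {d} ds → d ∈ ds → d ∣ foldr lcm 1 ds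
∈⇒∣lcm (d ∷ ds) (here refl) = m∣lcm[m,n] d _
∈⇒∣lcm (e ∷ ds) (there d∈)  = ∣-trans (∈⇒∣lcm ds d∈) (n∣lcm[m,n] e _)

applyUpTo-cong : ∀ {a} {X : Set a} (f g : ℕ → X) n → (∀ {j} → j < n → f j ≡ g j) → applyUpTo f n ≡ applyUpTo g n
applyUpTo-cong f g zero    eq = refl
applyUpTo-cong f g (suc n) eq = cong₂ _∷_ (eq (s≤s z≤n)) (applyUpTo-cong (f ∘ suc) (g ∘ suc) n (eq ∘ s≤s))

-- Constituents of the characteristic quasi-polynomial

module ArrangementProperties {m n l : ℕ} (A : Matrix m n) (B : Matrix l n) (a : Vector ℤ m) (b : Vector ℤ l) where
  open Arrangement A B a b

  -- Deleting the last column is right multiplication by the first n columns of the identity.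
  C≐C̄ : ∀ J → C J ≐ C̄ J · (λ x j → 1ₘ x (j ↑ˡ 1))
  C≐C̄ J i j = sym (trans (·-identityʳ (C̄ J) i (j ↑ˡ 1)) (lookup-++ˡ (C J i) _ j))

  d̄∣d : ∀ J j → d̄ J j ∣ d J j
  d̄∣d J = factor-∣-·ʳ (C J) (C̄ J) _ (C≐C̄ J)

  -- The last factor of a central J is a member of the lcm, and the earlier ones divide it.
  d∣ρC : ∀ {J} → J ∈ central → ∀ {j} → j ≤ r J → d J j ∣ ρC
  d∣ρC {J} J∈ j≤r = ∣-trans (factor-∣-mono (SmithForm.chain (smithForm (C J))) j≤r)
                            (∈⇒∣lcm _ (∈-map⁺ (λ J → d J (r J)) J∈))

  central⇒r̄≡r : ∀ {J} → J ∈ central → r̄ J ≡ r J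
  central⇒r̄≡r J∈ = proj₂ (∈-filter⁻ (λ J → r̄ J ℕ.≟ r J) {xs = subsets m} J∈)

  module _ {J} (J∈ : J ∈ central) (q q′ : ℕ) (gcd≡ : gcd q ρC ≡ gcd q′ ρC) where
    gcd-d : ∀ {j} → j ≤ r J → gcd q (d J j) ≡ gcd q′ (d J j)
    gcd-d j≤r = gcd-cong-∣ q q′ (d∣ρC J∈ j≤r) gcd≡

    gcd-d̄ : ∀ {j} → j ≤ r J → gcd q (d̄ J j) ≡ gcd q′ (d̄ J j)
    gcd-d̄ {j} j≤r = gcd-cong-∣ q q′ (∣-trans (d̄∣d J j) (d∣ρC J∈ j≤r)) gcd≡

    dcount-cong : dcount J q ≡ dcount J q′
    dcount-cong = cong product (applyUpTo-cong _ _ (r J) λ {j} j<r →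
      trans (gcd-comm (d J (suc j)) q) (trans (gcd-d j<r) (gcd-comm q′ (d J (suc j)))))

    d̃-cong : d̃ J q ≡ d̃ J q′
    d̃-cong = cong₂ (λ t x → if t then x else 0)
      (does-⇔ (mk⇔ (λ eq j → trans (sym (gcd-d (bound j))) (trans (eq j) (gcd-d̄ (bound j))))
                    (λ eq j → trans (gcd-d (bound j)) (trans (eq j) (sym (gcd-d̄ (bound j))))))
        (Fin.all? λ _ → _ ℕ.≟ _) (Fin.all? λ _ → _ ℕ.≟ _))
      dcount-cong
      where
      -- Centrality keeps every index of the test at most r(J), where both factors divide `ρC`.
      bound : (j : Fin (r̄ J)) → suc (toℕ j) ≤ r J
      bound j = subst (suc (toℕ j) ≤_) (central⇒r̄≡r J∈) (Fin.toℕ<n j)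

  formula : ℕ → Polynomial
  formula i = sumₚ (map (λ J → monomial (fromℤ (sign J * + d̃ J i)) (n ∸ r J)) central)

  -- The coefficients are taken at `i` and the powers at `q`. Assuming only equal gcds covers both
  -- congruence modulo `ρC` and the case `i = gcd q ρC`.
  eval-formula : ∀ q i → gcd q ρC ≡ gcd i ρC → eval (formula i) (fromℤ (+ q)) ≡ fromℤ (χ-quasi q)
  eval-formula q i gcd≡ = eval-sumₚ _ _ (fromℤ (+ q)) central λ {J} J∈ →
    trans (eval-monomial (sign J * + d̃ J i) (+ q) (n ∸ r J))
          (cong (λ x → fromℤ (sign J * + x * (+ q) ℤ.^ (n ∸ r J))) (sym (d̃-cong J∈ q i gcd≡)))

  formula-constituent : ∀ i → IsConstituent ρC χ-quasi i (formula i)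
  formula-constituent i q _ ρ∣ = eval-formula q i (gcd-cong-mod q i ρ∣)

  -- Both sides take the values of `χ-quasi` at i, i + ρ_C, i + 2ρ_C and so on, all positive. Equal
  -- indices give part (1), different ones part (2).
  constituent≈formula : ∀ f i j → 1 ≤ i → 0 < ρC → gcd i ρC ≡ gcd j ρC →
                        IsConstituent ρC χ-quasi i f → f ≈ₚ formula j
  constituent≈formula f i j 1≤i ρ>0 gcd≡ const = ≈ₚ-from-progression f (formula j) i ρC ρ>0 agree
    where
    agree : ∀ k → eval f (fromℤ (+ (i ℕ.+ k ℕ.* ρC))) ≡ eval (formula j) (fromℤ (+ (i ℕ.+ k ℕ.* ρC)))
    agree k = trans (const q (ℕ.≤-trans 1≤i (ℕ.m≤m+n i (k ℕ.* ρC))) ρ∣)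
                    (sym (eval-formula q j (trans (gcd-cong-mod q i ρ∣) gcd≡)))
      where
      q = i ℕ.+ k ℕ.* ρC
      ρ∣ : ρC ∣ ∣ q - i ∣
      ρ∣ = subst (ρC ∣_) (sym (trans (ℕ.∣-∣-comm q i) (ℕ.∣m-m+n∣≡n i (k ℕ.* ρC)))) (n∣m*n k)

theorem2p5 : ∀ (m n l : ℕ) (A : Matrix m n) (B : Matrix l n) (a : Vector ℤ m) (b : Vector ℤ l) →
    let open Arrangement A B a b in
    (∀ j → 1 ≤ j → j ≤ ρC → ∃ λ g → IsConstituent ρC χ-quasi j g) ×
    (∀ (f : ℕ → Polynomial) → (∀ j → 1 ≤ j → j ≤ ρC → IsConstituent ρC χ-quasi j (f j)) →
      (∀ i → 1 ≤ i → i ≤ ρC →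
        f i ≈ₚ sumₚ (map (λ J → monomial (fromℤ (sign J * + d̃ J i)) (n ∸ r J)) central)) ×
      (∀ i j → 1 ≤ i → i ≤ ρC → 1 ≤ j → j ≤ ρC → gcd i ρC ≡ gcd j ρC → f i ≈ₚ f j) ×
      (∀ q i → q₀ < q → 1 ≤ i → i ≤ ρC → gcd q ρC ≡ i →
        fromℤ (χ-quasi q) ≡ eval (f i) (fromℤ (+ q))))
theorem2p5 m n l A B a b =
  (λ j _ _ → formula j , formula-constituent j) ,
  λ f const →
    let f≈formula : ∀ i j → 1 ≤ i → i ≤ ρC → gcd i ρC ≡ gcd j ρC → f i ≈ₚ formula j
        f≈formula = λ i j 1≤i i≤ρ gcd≡ →
          constituent≈formula (f i) i j 1≤i (ℕ.≤-trans 1≤i i≤ρ) gcd≡ (const i 1≤i i≤ρ)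
    in
    (λ i 1≤i i≤ρ → f≈formula i i 1≤i i≤ρ refl) ,
    (λ i j 1≤i i≤ρ 1≤j j≤ρ gcd≡ k →
      trans (f≈formula i j 1≤i i≤ρ gcd≡ k) (sym (f≈formula j j 1≤j j≤ρ refl k))) ,
    -- By `gcd-idem`, `i = gcd q ρC` has the same gcd with `ρC` as `q`, so `formula i` gives the
    -- value at `q`.
    (λ q i _ 1≤i i≤ρ gcd≡i →
      sym (trans (eval-cong (f i) (formula i) (fromℤ (+ q)) (f≈formula i i 1≤i i≤ρ refl))
                 (eval-formula q i (trans (sym (gcd-idem q ρC)) (cong (λ g → gcd g ρC) gcd≡i)))))
  where
  open Arrangement A B a b using (ρC)
  open ArrangementProperties A B a b
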